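{- When $n$ is large there exists a graph $G$ of order $n$ such that $$ \gamma_g(G)\ge\frac{\ln(\delta'+1)+\ln 2+1}{\delta'+1}\,n\,(1+o(1)), $$ where $\delta'=\min\{\delta(G),\delta(\overline{G})\}$ and $o(1)$ denotes a quantity tending to $0$ as $n\to\infty$.
   Context: All graphs are finite and undirected, without loops or multiple edges. $\delta(G)$ denotes the minimum degree of $G$ and $\overline{G}$ its complement. A set $X\subseteq V(G)$ is a dominating set of $G$ if every vertex not in $X$ is adjacent in $G$ to a vertex in $X$. A set $X\subseteq V(G)$ is a global dominating set of $G$ if it is a dominating set both in $G$ and in $\overline{G}$. The global domination number $\gamma_g(G)$ is the minimum cardinality of a global dominating set of $G$. -}

module Defs where

open import Data.Fin.Base using (Fin)
import Data.Fin.Properties as Fin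
open import Data.Fin.Subset using (Subset; inside; outside; _∈_; _∉_; ∣_∣)
open import Data.Fin.Subset.Properties using (_∈?_)
open import Data.Integer.Base as ℤ using (+_)
import Data.Integer.Properties as ℤ
import Data.Integer.Solver as ℤ
open import Data.List.Base using (List; []; _∷_; _++_; map; filter; allFin)
open import Data.List.Extrema.Nat using (min)
open import Data.Nat.Base as ℕ using (ℕ; zero; suc; _⊓_)
import Data.Nat.Properties as ℕ
open import Data.Product.Base using (∃-syntax; _×_; _,_; proj₁; proj₂)
open import Data.Rational.Base as ℚ using (ℚ; mkℚ; 0ℚ; 1ℚ; ½; _/_)
import Data.Rational.Properties as ℚ
open import Data.Rational.Solver using (module +-*-Solver)
import Data.Rational.Unnormalised.Base as ℚᵘ
import Data.Rational.Unnormalised.Properties as ℚᵘ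
open import Data.Sum.Base using (inj₁; inj₂)
open import Data.Vec.Base using ([]; _∷_; tabulate)
open import Level using (0ℓ)
open import Relation.Binary.Core using (Rel)
open import Relation.Binary.Definitions using (Decidable; Symmetric; Irreflexive)
open import Relation.Binary.PropositionalEquality
  using (_≡_; _≢_; refl; sym; trans; cong; cong₂; subst; subst₂)
open import Relation.Nullary using (¬_; does)
open import Relation.Nullary.Decidable using (¬?; _×-dec_; _→-dec_)
import Relation.Unary as U

------------------------------------------------------------------------
-- Graphs

record Graph (n : ℕ) : Set₁ where
  field
    Adj    : Rel (Fin n) 0ℓ
    adj?   : Decidable Adj
    symm   : Symmetric Adj
    irrefl : Irreflexive _≡_ Adj

open Graph public

complement : ∀ {n} → Graph n → Graph n
complement G .Adj u v = u ≢ v × ¬ Adj G u v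
complement G .adj? u v = ¬? (u Fin.≟ v) ×-dec ¬? (adj? G u v)
complement G .symm (u≢v , ¬uv) = (λ v≡u → u≢v (sym v≡u)) , λ vu → ¬uv (symm G vu)
complement G .irrefl u≡v (u≢v , _) = u≢v u≡v

neighbours : ∀ {n} → Graph n → Fin n → Subset n
neighbours G u = tabulate λ v → does (adj? G u v)

degree : ∀ {n} → Graph n → Fin n → ℕ
degree G u = ∣ neighbours G u ∣

-- All degrees are less than n, so the default value n of the minimum is
-- attained only for n = 0.
δ : ∀ {n} → Graph n → ℕ
δ {n} G = min n (map (degree G) (allFin n))

δ′ : ∀ {n} → Graph n → ℕ
δ′ G = δ G ⊓ δ (complement G)

Dominating : ∀ {n} → Graph n → Subset n → Set
Dominating G X = ∀ v → v ∉ X → ∃[ u ] u ∈ X × Adj G v u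

dominating? : ∀ {n} (G : Graph n) → U.Decidable (Dominating G)
dominating? G X = Fin.all? λ v →
  ¬? (v ∈? X) →-dec Fin.any? λ u → (u ∈? X) ×-dec adj? G v u

GlobalDominating : ∀ {n} → Graph n → Subset n → Set
GlobalDominating G X = Dominating G X × Dominating (complement G) X

globalDominating? : ∀ {n} (G : Graph n) → U.Decidable (GlobalDominating G)
globalDominating? G X = dominating? G X ×-dec dominating? (complement G) X

subsets : ∀ n → List (Subset n)
subsets zero    = [] ∷ []
subsets (suc n) = map (outside ∷_) (subsets n) ++ map (inside ∷_) (subsets n)

-- The default value n is harmless: the full vertex set is a global
-- dominating set of cardinality n.
γg : ∀ {n} → Graph n → ℕ
γg {n} G = min n (map ∣_∣ (filter (globalDominating? G) (subsets n)))

------------------------------------------------------------------------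
-- Real numbers, as Cauchy sequences of rationals

IsCauchy : (ℕ → ℚ) → Set
IsCauchy s = ∀ ε → 0ℚ ℚ.< ε →
  ∃[ N ] ∀ m n → N ℕ.≤ m → N ℕ.≤ n → ℚ.∣ s m ℚ.- s n ∣ ℚ.≤ ε

record ℝ : Set where
  field
    seq    : ℕ → ℚ
    cauchy : IsCauchy seq

open ℝ public

infix  4 _≤ᴿ_ _≥ᴿ_
infixl 6 _+ᴿ_
infixl 7 _*ᴿ_ _÷ᴿ_

_≤ᴿ_ : ℝ → ℝ → Set
x ≤ᴿ y = ∀ ε → 0ℚ ℚ.< ε → ∃[ N ] ∀ n → N ℕ.≤ n → seq x n ℚ.≤ seq y n ℚ.+ ε

_≥ᴿ_ : ℝ → ℝ → Set
x ≥ᴿ y = y ≤ᴿ x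

fromℚ : ℚ → ℝ
fromℚ p .seq _ = p
fromℚ p .cauchy ε 0<ε = 0 , λ _ _ _ _ →
  subst (ℚ._≤ ε) (sym (cong ℚ.∣_∣ (ℚ.+-inverseʳ p))) (ℚ.<⇒≤ 0<ε)

fromℕ : ℕ → ℝ
fromℕ n = fromℚ (+ n / 1)

open +-*-Solver using (solve; _:+_; _:*_; _:-_; :-_; _:=_)

half-pos : ∀ {ε} → 0ℚ ℚ.< ε → 0ℚ ℚ.< ½ ℚ.* ε
half-pos {ε} 0<ε = subst (ℚ._< ½ ℚ.* ε) (ℚ.*-zeroʳ ½) (ℚ.*-monoʳ-<-pos ½ 0<ε)

half+half : ∀ ε → ½ ℚ.* ε ℚ.+ ½ ℚ.* ε ≡ ε
half+half ε = trans (sym (ℚ.*-distribʳ-+ ε ½ ½)) (ℚ.*-identityˡ ε)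

∣∣-≤ : ∀ {p ε} → p ℚ.≤ ε → ℚ.- p ℚ.≤ ε → ℚ.∣ p ∣ ℚ.≤ ε
∣∣-≤ {p} p≤ε -p≤ε with ℚ.∣p∣≡p∨∣p∣≡-p p
... | inj₁ e = subst (ℚ._≤ _) (sym e) p≤ε
... | inj₂ e = subst (ℚ._≤ _) (sym e) -p≤ε

*-mono-≤-nonNeg : ∀ {p q r s} → 0ℚ ℚ.≤ r → 0ℚ ℚ.≤ q → p ℚ.≤ q → r ℚ.≤ s →
                  p ℚ.* r ℚ.≤ q ℚ.* s
*-mono-≤-nonNeg {q = q} {r} 0≤r 0≤q p≤q r≤s = ℚ.≤-trans
  (ℚ.*-monoʳ-≤-nonNeg r {{ℚ.nonNegative 0≤r}} p≤q)
  (ℚ.*-monoˡ-≤-nonNeg q {{ℚ.nonNegative 0≤q}} r≤s)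

Bound : (ℕ → ℚ) → Set
Bound s = ∃[ B ] ∃[ N ] (0ℚ ℚ.< B × ∀ n → N ℕ.≤ n → ℚ.∣ s n ∣ ℚ.≤ B)

bounded : ∀ x → Bound (seq x)
bounded x with cauchy x 1ℚ (ℚ.positive⁻¹ 1ℚ)
... | N , h = 1ℚ ℚ.+ ℚ.∣ seq x N ∣ , N , 0<B , λ n N≤n →
  ℚ.≤-trans (ℚ.≤-trans
    (ℚ.≤-reflexive (cong ℚ.∣_∣ (lem (seq x n) (seq x N))))
    (ℚ.∣p+q∣≤∣p∣+∣q∣ (seq x n ℚ.- seq x N) (seq x N)))
    (ℚ.+-monoˡ-≤ ℚ.∣ seq x N ∣ (h n N N≤n ℕ.≤-refl))
  where
  lem : ∀ a b → a ≡ (a ℚ.- b) ℚ.+ b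
  lem = solve 2 (λ a b → a := (a :- b) :+ b) refl
  0<B : 0ℚ ℚ.< 1ℚ ℚ.+ ℚ.∣ seq x N ∣
  0<B = ℚ.+-mono-<-≤ (ℚ.positive⁻¹ 1ℚ) (ℚ.0≤∣p∣ (seq x N))

_+ᴿ_ : ℝ → ℝ → ℝ
(x +ᴿ y) .seq n = seq x n ℚ.+ seq y n
(x +ᴿ y) .cauchy ε 0<ε
  with cauchy x (½ ℚ.* ε) (half-pos 0<ε) | cauchy y (½ ℚ.* ε) (half-pos 0<ε)
... | M , f | N , g = M ℕ.⊔ N , λ m n M⊔N≤m M⊔N≤n → begin
  ℚ.∣ (seq x m ℚ.+ seq y m) ℚ.- (seq x n ℚ.+ seq y n) ∣
    ≡⟨ cong ℚ.∣_∣ (lem (seq x m) (seq y m) (seq x n) (seq y n)) ⟩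
  ℚ.∣ (seq x m ℚ.- seq x n) ℚ.+ (seq y m ℚ.- seq y n) ∣
    ≤⟨ ℚ.∣p+q∣≤∣p∣+∣q∣ (seq x m ℚ.- seq x n) (seq y m ℚ.- seq y n) ⟩
  ℚ.∣ seq x m ℚ.- seq x n ∣ ℚ.+ ℚ.∣ seq y m ℚ.- seq y n ∣
    ≤⟨ ℚ.+-mono-≤ (f m n (ℕ.m⊔n≤o⇒m≤o M N M⊔N≤m) (ℕ.m⊔n≤o⇒m≤o M N M⊔N≤n))
                  (g m n (ℕ.m⊔n≤o⇒n≤o M N M⊔N≤m) (ℕ.m⊔n≤o⇒n≤o M N M⊔N≤n)) ⟩
  ½ ℚ.* ε ℚ.+ ½ ℚ.* ε
    ≡⟨ half+half ε ⟩
  ε ∎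
  where
  open ℚ.≤-Reasoning
  lem : ∀ a b c d → (a ℚ.+ b) ℚ.- (c ℚ.+ d) ≡ (a ℚ.- c) ℚ.+ (b ℚ.- d)
  lem = solve 4 (λ a b c d → (a :+ b) :- (c :+ d) := (a :- c) :+ (b :- d)) refl

_*ᴿ_ : ℝ → ℝ → ℝ
(x *ᴿ y) .seq n = seq x n ℚ.* seq y n
(x *ᴿ y) .cauchy ε 0<ε = M , λ m n M≤m M≤n → begin
  ℚ.∣ seq x m ℚ.* seq y m ℚ.- seq x n ℚ.* seq y n ∣
    ≡⟨ cong ℚ.∣_∣ (lem (seq x m) (seq y m) (seq x n) (seq y n)) ⟩
  ℚ.∣ seq x m ℚ.* (seq y m ℚ.- seq y n) ℚ.+ seq y n ℚ.* (seq x m ℚ.- seq x n) ∣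
    ≤⟨ ℚ.∣p+q∣≤∣p∣+∣q∣ (seq x m ℚ.* (seq y m ℚ.- seq y n))
                       (seq y n ℚ.* (seq x m ℚ.- seq x n)) ⟩
  ℚ.∣ seq x m ℚ.* (seq y m ℚ.- seq y n) ∣ ℚ.+ ℚ.∣ seq y n ℚ.* (seq x m ℚ.- seq x n) ∣
    ≡⟨ cong₂ ℚ._+_ (ℚ.∣p*q∣≡∣p∣*∣q∣ (seq x m) (seq y m ℚ.- seq y n))
                   (ℚ.∣p*q∣≡∣p∣*∣q∣ (seq y n) (seq x m ℚ.- seq x n)) ⟩
  ℚ.∣ seq x m ∣ ℚ.* ℚ.∣ seq y m ℚ.- seq y n ∣ ℚ.+ ℚ.∣ seq y n ∣ ℚ.* ℚ.∣ seq x m ℚ.- seq x n ∣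
    ≤⟨ ℚ.+-mono-≤
         (*-mono-≤-nonNeg (ℚ.0≤∣p∣ _) (ℚ.<⇒≤ 0<B)
           (boundX m (ℕ.≤-trans Nx≤M M≤m)) (cauchyY m n (ℕ.≤-trans My≤M M≤m) (ℕ.≤-trans My≤M M≤n)))
         (*-mono-≤-nonNeg (ℚ.0≤∣p∣ _) (ℚ.<⇒≤ 0<C)
           (boundY n (ℕ.≤-trans Ny≤M M≤n)) (cauchyX m n (ℕ.≤-trans Mx≤M M≤m) (ℕ.≤-trans Mx≤M M≤n))) ⟩
  B ℚ.* η ℚ.+ C ℚ.* η
    ≡⟨ ℚ.*-distribʳ-+ η B C ⟨
  (B ℚ.+ C) ℚ.* (ℚ.1/ (B ℚ.+ C) ℚ.* ε)
    ≡⟨ ℚ.*-assoc (B ℚ.+ C) (ℚ.1/ (B ℚ.+ C)) ε ⟨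
  (B ℚ.+ C) ℚ.* ℚ.1/ (B ℚ.+ C) ℚ.* ε
    ≡⟨ cong (ℚ._* ε) (ℚ.*-inverseʳ (B ℚ.+ C)) ⟩
  1ℚ ℚ.* ε
    ≡⟨ ℚ.*-identityˡ ε ⟩
  ε ∎
  where
  open ℚ.≤-Reasoning
  B C η : ℚ
  B = proj₁ (bounded x)
  C = proj₁ (bounded y)
  Nx Ny Mx My M : ℕ
  Nx = proj₁ (proj₂ (bounded x))
  Ny = proj₁ (proj₂ (bounded y))
  0<B : 0ℚ ℚ.< B
  0<B = proj₁ (proj₂ (proj₂ (bounded x)))
  0<C : 0ℚ ℚ.< C
  0<C = proj₁ (proj₂ (proj₂ (bounded y)))
  boundX : ∀ n → Nx ℕ.≤ n → ℚ.∣ seq x n ∣ ℚ.≤ B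
  boundX = proj₂ (proj₂ (proj₂ (bounded x)))
  boundY : ∀ n → Ny ℕ.≤ n → ℚ.∣ seq y n ∣ ℚ.≤ C
  boundY = proj₂ (proj₂ (proj₂ (bounded y)))
  instance
    posB+C : ℚ.Positive (B ℚ.+ C)
    posB+C = ℚ.positive (ℚ.+-mono-< 0<B 0<C)
    nonZeroB+C : ℚ.NonZero (B ℚ.+ C)
    nonZeroB+C = ℚ.pos⇒nonZero (B ℚ.+ C)
  η = ℚ.1/ (B ℚ.+ C) ℚ.* ε
  0<η : 0ℚ ℚ.< η
  0<η = subst (ℚ._< η) (ℚ.*-zeroʳ (ℚ.1/ (B ℚ.+ C)))
    (ℚ.*-monoʳ-<-pos (ℚ.1/ (B ℚ.+ C)) {{ℚ.1/pos⇒pos (B ℚ.+ C)}} 0<ε)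
  Mx = proj₁ (cauchy x η 0<η)
  My = proj₁ (cauchy y η 0<η)
  cauchyX : ∀ m n → Mx ℕ.≤ m → Mx ℕ.≤ n → ℚ.∣ seq x m ℚ.- seq x n ∣ ℚ.≤ η
  cauchyX = proj₂ (cauchy x η 0<η)
  cauchyY : ∀ m n → My ℕ.≤ m → My ℕ.≤ n → ℚ.∣ seq y m ℚ.- seq y n ∣ ℚ.≤ η
  cauchyY = proj₂ (cauchy y η 0<η)
  M = (Nx ℕ.⊔ Ny) ℕ.⊔ (Mx ℕ.⊔ My)
  Nx≤M : Nx ℕ.≤ M
  Nx≤M = ℕ.≤-trans (ℕ.m≤m⊔n Nx Ny) (ℕ.m≤m⊔n (Nx ℕ.⊔ Ny) (Mx ℕ.⊔ My))
  Ny≤M : Ny ℕ.≤ M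
  Ny≤M = ℕ.≤-trans (ℕ.m≤n⊔m Nx Ny) (ℕ.m≤m⊔n (Nx ℕ.⊔ Ny) (Mx ℕ.⊔ My))
  Mx≤M : Mx ℕ.≤ M
  Mx≤M = ℕ.≤-trans (ℕ.m≤m⊔n Mx My) (ℕ.m≤n⊔m (Nx ℕ.⊔ Ny) (Mx ℕ.⊔ My))
  My≤M : My ℕ.≤ M
  My≤M = ℕ.≤-trans (ℕ.m≤n⊔m Mx My) (ℕ.m≤n⊔m (Nx ℕ.⊔ Ny) (Mx ℕ.⊔ My))
  lem : ∀ a b c d → a ℚ.* b ℚ.- c ℚ.* d ≡ a ℚ.* (b ℚ.- d) ℚ.+ d ℚ.* (a ℚ.- c)
  lem = solve 4 (λ a b c d → a :* b :- c :* d := a :* (b :- d) :+ d :* (a :- c)) refl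

_÷ᴿ_ : ℝ → (d : ℕ) .{{_ : ℕ.NonZero d}} → ℝ
x ÷ᴿ d = x *ᴿ fromℚ (+ 1 / d)

------------------------------------------------------------------------
-- The natural logarithm of a positive integer

harmonic : ℕ → ℚ
harmonic zero    = 0ℚ
harmonic (suc n) = harmonic n ℚ.+ + 1 / suc n

-- ln m = ∫₁ᵐ dt/t.  With step 1/k, the right-endpoint Riemann sum is
-- Σ_{k<i≤mk} (1/k)·1/(i/k) = Σ_{k<i≤mk} 1/i.
lnSum : ℕ → ℕ → ℚ
lnSum m k = harmonic (m ℕ.* k) ℚ.- harmonic k

fraction-≤ : ∀ i j a b → i ℕ.* suc b ℕ.≤ j ℕ.* suc a →
             + i / suc a ℚ.≤ + j / suc b
fraction-≤ i j a b h = ℚ.toℚᵘ-cancel-≤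
  (ℚᵘ.≤-respˡ-≃ (ℚᵘ.≃-sym (ℚ.toℚᵘ-fromℚᵘ (ℚᵘ.mkℚᵘ (+ i) a)))
  (ℚᵘ.≤-respʳ-≃ (ℚᵘ.≃-sym (ℚ.toℚᵘ-fromℚᵘ (ℚᵘ.mkℚᵘ (+ j) b)))
  (ℚᵘ.*≤* (subst₂ ℤ._≤_ (ℤ.pos-* i (suc b)) (ℤ.pos-* j (suc a)) (ℤ.+≤+ h)))))

fraction-suc : ∀ k c → + suc k / suc c ≡ + k / suc c ℚ.+ + 1 / suc c
fraction-suc k c = ℚ.toℚᵘ-injective (begin-equality
  ℚ.toℚᵘ (+ suc k / suc c)
    ≃⟨ ℚ.toℚᵘ-fromℚᵘ (ℚᵘ.mkℚᵘ (+ suc k) c) ⟩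
  ℚᵘ.mkℚᵘ (+ suc k) c
    ≃⟨ ℚᵘ.*≡* (eq (+ k) (+ suc c)) ⟩
  ℚᵘ.mkℚᵘ (+ k) c ℚᵘ.+ ℚᵘ.mkℚᵘ (+ 1) c
    ≃⟨ ℚᵘ.+-cong (ℚ.toℚᵘ-fromℚᵘ (ℚᵘ.mkℚᵘ (+ k) c)) (ℚ.toℚᵘ-fromℚᵘ (ℚᵘ.mkℚᵘ (+ 1) c)) ⟨
  ℚ.toℚᵘ (+ k / suc c) ℚᵘ.+ ℚ.toℚᵘ (+ 1 / suc c)
    ≃⟨ ℚ.toℚᵘ-homo-+ (+ k / suc c) (+ 1 / suc c) ⟨
  ℚ.toℚᵘ (+ k / suc c ℚ.+ + 1 / suc c) ∎)
  where
  open ℚᵘ.≤-Reasoning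
  module S = ℤ.+-*-Solver
  eq : ∀ x y → (+ 1 ℤ.+ x) ℤ.* (y ℤ.* y) ≡ (x ℤ.* y ℤ.+ + 1 ℤ.* y) ℤ.* y
  eq = S.solve 2 (λ x y → (S.con (+ 1) S.:+ x) S.:* (y S.:* y)
                     S.:= (x S.:* y S.:+ S.con (+ 1) S.:* y) S.:* y) refl

archimedean : ∀ ε → 0ℚ ℚ.< ε → ∃[ N ] + 1 / suc N ℚ.≤ ε
archimedean ε@(mkℚ (+ suc a) d _) _ = d ,
  subst (+ 1 / suc d ℚ.≤_) (ℚ.fromℚᵘ-toℚᵘ ε)
    (fraction-≤ 1 (suc a) d d (ℕ.*-monoˡ-≤ (suc d) {1} {suc a} (ℕ.s≤s ℕ.z≤n)))
archimedean (mkℚ (+ 0) d _) (ℚ.*<* (ℤ.+<+ ()))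
archimedean (mkℚ (ℤ.-[1+ _ ]) d _) (ℚ.*<* ())

harmonic-lower : ∀ a k c → a ℕ.+ k ℕ.≤ suc c →
                 harmonic a ℚ.+ + k / suc c ℚ.≤ harmonic (k ℕ.+ a)
harmonic-lower a zero    c _ = ℚ.≤-trans
  (ℚ.+-monoʳ-≤ (harmonic a) (fraction-≤ 0 0 c 0 ℕ.z≤n))
  (ℚ.≤-reflexive (ℚ.+-identityʳ (harmonic a)))
harmonic-lower a (suc k) c h = begin
  harmonic a ℚ.+ + suc k / suc c
    ≡⟨ cong (harmonic a ℚ.+_) (fraction-suc k c) ⟩
  harmonic a ℚ.+ (+ k / suc c ℚ.+ + 1 / suc c)
    ≡⟨ ℚ.+-assoc (harmonic a) (+ k / suc c) (+ 1 / suc c) ⟨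
  harmonic a ℚ.+ + k / suc c ℚ.+ + 1 / suc c
    ≤⟨ ℚ.+-mono-≤ (harmonic-lower a k c (ℕ.<⇒≤ h′))
         (fraction-≤ 1 1 c (k ℕ.+ a) (ℕ.*-monoʳ-≤ 1 (subst (ℕ._≤ suc c) (cong suc (ℕ.+-comm a k)) h′))) ⟩
  harmonic (k ℕ.+ a) ℚ.+ + 1 / suc (k ℕ.+ a) ∎
  where
  open ℚ.≤-Reasoning
  h′ : a ℕ.+ k ℕ.< suc c
  h′ = subst (ℕ._≤ suc c) (ℕ.+-suc a k) h

harmonic-upper : ∀ a k c → c ℕ.≤ a →
                 harmonic (k ℕ.+ a) ℚ.≤ harmonic a ℚ.+ + k / suc c
harmonic-upper a zero    c _ = ℚ.≤-trans
  (ℚ.≤-reflexive (sym (ℚ.+-identityʳ (harmonic a))))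
  (ℚ.+-monoʳ-≤ (harmonic a) (fraction-≤ 0 0 0 c ℕ.z≤n))
harmonic-upper a (suc k) c h = begin
  harmonic (k ℕ.+ a) ℚ.+ + 1 / suc (k ℕ.+ a)
    ≤⟨ ℚ.+-mono-≤ (harmonic-upper a k c h)
         (fraction-≤ 1 1 (k ℕ.+ a) c (ℕ.*-monoʳ-≤ 1 (ℕ.s≤s (ℕ.≤-trans h (ℕ.m≤n+m a k))))) ⟩
  harmonic a ℚ.+ + k / suc c ℚ.+ + 1 / suc c
    ≡⟨ ℚ.+-assoc (harmonic a) (+ k / suc c) (+ 1 / suc c) ⟩
  harmonic a ℚ.+ (+ k / suc c ℚ.+ + 1 / suc c)
    ≡⟨ cong (harmonic a ℚ.+_) (fraction-suc k c) ⟨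
  harmonic a ℚ.+ + suc k / suc c ∎
  where open ℚ.≤-Reasoning

module LnCauchy (m′ : ℕ) where
  m : ℕ
  m = suc m′

  s : ℕ → ℚ
  s k = lnSum m (suc k)

  open ℚ.≤-Reasoning

  step : ∀ k → m ℕ.+ m ℕ.* suc k ≡ m ℕ.* suc (suc k)
  step k = sym (ℕ.*-suc m (suc k))

  s-mono₁ : ∀ k → s k ℚ.≤ s (suc k)
  s-mono₁ k = begin
    a ℚ.- h
      ≡⟨ lem a h u ⟩
    (a ℚ.+ u) ℚ.- (h ℚ.+ u)
      ≤⟨ ℚ.+-monoˡ-≤ (ℚ.- (h ℚ.+ u)) (ℚ.≤-trans (ℚ.+-monoʳ-≤ a
           (fraction-≤ 1 m (suc k) (suc k ℕ.+ m′ ℕ.* suc (suc k))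
             (ℕ.≤-reflexive (ℕ.*-identityˡ (m ℕ.* suc (suc k))))))
           (harmonic-lower (m ℕ.* suc k) m (suc k ℕ.+ m′ ℕ.* suc (suc k))
             (ℕ.≤-reflexive (trans (ℕ.+-comm (m ℕ.* suc k) m) (step k))))) ⟩
    harmonic (m ℕ.+ m ℕ.* suc k) ℚ.- (h ℚ.+ u)
      ≡⟨ cong (λ i → harmonic i ℚ.- (h ℚ.+ u)) (step k) ⟩
    s (suc k) ∎
    where
    a h u : ℚ
    a = harmonic (m ℕ.* suc k)
    h = harmonic (suc k)
    u = + 1 / suc (suc k)
    lem : ∀ a h u → a ℚ.- h ≡ (a ℚ.+ u) ℚ.- (h ℚ.+ u)
    lem = solve 3 (λ a h u → a :- h := (a :+ u) :- (h :+ u)) refl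

  s-anti₁ : ∀ k → s (suc k) ℚ.+ + 1 / suc (suc k) ℚ.≤ s k ℚ.+ + 1 / suc k
  s-anti₁ k = begin
    harmonic (m ℕ.* suc (suc k)) ℚ.- (h ℚ.+ u) ℚ.+ u
      ≡⟨ cong (λ i → harmonic i ℚ.- (h ℚ.+ u) ℚ.+ u) (step k) ⟨
    harmonic (m ℕ.+ m ℕ.* suc k) ℚ.- (h ℚ.+ u) ℚ.+ u
      ≡⟨ lem₁ (harmonic (m ℕ.+ m ℕ.* suc k)) h u ⟩
    harmonic (m ℕ.+ m ℕ.* suc k) ℚ.- h
      ≤⟨ ℚ.+-monoˡ-≤ (ℚ.- h) (ℚ.≤-trans
           (harmonic-upper (m ℕ.* suc k) m (k ℕ.+ m′ ℕ.* suc k) (ℕ.n≤1+n _))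
           (ℚ.+-monoʳ-≤ a (fraction-≤ m 1 (k ℕ.+ m′ ℕ.* suc k) k
             (ℕ.≤-reflexive (sym (ℕ.*-identityˡ (m ℕ.* suc k))))))) ⟩
    (a ℚ.+ v) ℚ.- h
      ≡⟨ lem₂ a v h ⟩
    s k ℚ.+ v ∎
    where
    a h u v : ℚ
    a = harmonic (m ℕ.* suc k)
    h = harmonic (suc k)
    u = + 1 / suc (suc k)
    v = + 1 / suc k
    lem₁ : ∀ a h u → a ℚ.- (h ℚ.+ u) ℚ.+ u ≡ a ℚ.- h
    lem₁ = solve 3 (λ a h u → a :- (h :+ u) :+ u := a :- h) refl
    lem₂ : ∀ a v h → (a ℚ.+ v) ℚ.- h ≡ a ℚ.- h ℚ.+ v
    lem₂ = solve 3 (λ a v h → (a :+ v) :- h := a :- h :+ v) refl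

  s-mono : ∀ {k l} → k ℕ.≤′ l → s k ℚ.≤ s l
  s-mono (ℕ.≤′-reflexive refl) = ℚ.≤-refl
  s-mono {l = suc l} (ℕ.≤′-step k≤l) = ℚ.≤-trans (s-mono k≤l) (s-mono₁ l)

  s-anti : ∀ {k l} → k ℕ.≤′ l → s l ℚ.+ + 1 / suc l ℚ.≤ s k ℚ.+ + 1 / suc k
  s-anti (ℕ.≤′-reflexive refl) = ℚ.≤-refl
  s-anti {l = suc l} (ℕ.≤′-step k≤l) = ℚ.≤-trans (s-anti₁ l) (s-anti k≤l)

  s-close : ∀ N i j → N ℕ.≤ i → N ℕ.≤ j → s i ℚ.- s j ℚ.≤ + 1 / suc N
  s-close N i j N≤i N≤j = begin
    s i ℚ.- s j
      ≤⟨ ℚ.+-mono-≤ si≤ (ℚ.neg-antimono-≤ (s-mono (ℕ.≤⇒≤′ N≤j))) ⟩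
    (s N ℚ.+ + 1 / suc N) ℚ.- s N
      ≡⟨ lem (s N) (+ 1 / suc N) ⟩
    + 1 / suc N ∎
    where
    si≤ : s i ℚ.≤ s N ℚ.+ + 1 / suc N
    si≤ = ℚ.≤-trans
      (ℚ.≤-trans (ℚ.≤-reflexive (sym (ℚ.+-identityʳ (s i))))
        (ℚ.+-monoʳ-≤ (s i) (fraction-≤ 0 1 0 i ℕ.z≤n)))
      (s-anti (ℕ.≤⇒≤′ N≤i))
    lem : ∀ a b → (a ℚ.+ b) ℚ.- a ≡ b
    lem = solve 2 (λ a b → (a :+ b) :- a := b) refl

  s-cauchy : IsCauchy s
  s-cauchy ε 0<ε with archimedean ε 0<ε
  ... | N , 1/N≤ε = N , λ i j N≤i N≤j → ∣∣-≤
    (ℚ.≤-trans (s-close N i j N≤i N≤j) 1/N≤ε)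
    (ℚ.≤-trans (ℚ.≤-reflexive (lem (s i) (s j)))
      (ℚ.≤-trans (s-close N j i N≤j N≤i) 1/N≤ε))
    where
    lem : ∀ a b → ℚ.- (a ℚ.- b) ≡ b ℚ.- a
    lem = solve 2 (λ a b → :- (a :- b) := b :- a) refl

ln : (m : ℕ) .{{_ : ℕ.NonZero m}} → ℝ
ln m       .seq k  = lnSum m (suc k)
ln (suc m) .cauchy = LnCauchy.s-cauchy m

------------------------------------------------------------------------
-- Null sequences

TendsToZero : (ℕ → ℝ) → Set
TendsToZero o = ∀ ε → 0ℚ ℚ.< ε →
  ∃[ N ] ∀ n → N ℕ.≤ n → fromℚ (ℚ.- ε) ≤ᴿ o n × o n ≤ᴿ fromℚ ε

{-# OPTIONS --safe #-}
module Submission where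

-- If δ′ → ∞, then the summand ln 2 + 1 is absorbed by o(1), so it suffices to find graphs with
-- domination number at least (1 - o(1)) q ln n and δ′ ≈ n / q, for a slowly growing q.
-- A random subset of size a / q of Fin a misses a given set of t elements with probability
-- about (1 - 1/q)ᵗ = n^(-1+ε) when t = (1 - ε) q ln n, so a greedy choice yields n^(1-ε) polylog(n)
-- subsets S i such that every set of size t is missed by one of them. Joining t + 1
-- new vertices to each S i gives a graph without dominating sets of size t that has only
-- o(n) vertices outside Fin a; a complete bipartite graph on Fin a makes all degrees and codegrees
-- at least a / q.

open import Defs
open import Data.Bool.Base using (Bool; true; false; not; T; _xor_; if_then_else_)
open import Data.Bool.Properties using (T?; T-≡; xor-same; xor-comm; not-injective)
open import Data.Empty using (⊥; ⊥-elim)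
open import Data.Fin.Base using (Fin; zero; suc; splitAt; _↑ˡ_; _↑ʳ_; combine; remQuot)
open import Data.Fin.Properties as Fin
  using (splitAt-↑ˡ; splitAt-↑ʳ; splitAt⁻¹-↑ˡ; ↑ʳ-injective; combine-injectiveʳ; remQuot-combine)
open import Data.Fin.Subset as Subset using (Subset; inside; outside; _∈_; ∣_∣; ∁; _-_)
open import Data.Fin.Subset.Properties
  using (_∈?_; ∣p∣≤n; ∣⊥∣≡0; ∣∁p∣≡n∸∣p∣; x∈p⇒∣p-x∣<∣p∣; x∈p∧x≢y⇒x∈p-y)
open import Data.Integer.Base using () renaming (+_ to pos)
import Data.Integer.Properties as ℤ
open import Data.List.Base using (List; []; _∷_; _++_; map; length; filterᵇ; allFin)
open import Data.List.Extrema.Nat using (v≤min⁺; min≤⊤)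
open import Data.List.Membership.Propositional using () renaming (_∈_ to _∈ᴸ_)
open import Data.List.Membership.Propositional.Properties using (∈-filter⁺; ∈-++⁺ˡ; ∈-++⁺ʳ; ∈-map⁺)
open import Data.List.Properties using (map-++; map-∘; length-++; length-map)
open import Data.List.Relation.Unary.All as All using (All; []; _∷_)
import Data.List.Relation.Unary.All.Properties as All
open import Data.List.Relation.Unary.Any using (here; there)
open import Data.Nat.Base as ℕ hiding (_/_; _%_)
open import Data.Nat.Combinatorics using (_C_; nCk+nC[k+1]≡[n+1]C[k+1])
open import Data.Nat.DivMod using (m/n*n≤m; m≡m%n+[m/n]*n; m%n<n)
open import Data.Nat.ListAction using (sum)
open import Data.Nat.ListAction.Properties using (sum-++)
open import Data.Nat.Properties
open import Data.Nat.Tactic.RingSolver using (solve-∀)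
open import Data.Product.Base using (Σ-syntax; ∃-syntax; _×_; _,_; proj₁; proj₂)
open import Data.Rational.Base as ℚ using (ℚ; 0ℚ; 1ℚ; _/_)
import Data.Rational.Properties as ℚ
open import Data.Rational.Solver using (module +-*-Solver)
import Data.Rational.Unnormalised.Base as ℚᵘ
import Data.Rational.Unnormalised.Properties as ℚᵘ
open import Data.Sum.Base using (_⊎_; inj₁; inj₂)
open import Data.Sum.Properties using (inj₁-injective)
open import Data.Unit.Base using (tt)
open import Data.Vec.Base using ([]; _∷_; here; there; lookup; tabulate)
open import Data.Vec.Properties
  using ([]=⇒lookup; lookup⇒[]=; tabulate∘lookup; lookup∘tabulate; lookup-map)
open import Function.Base using (_∘_)
open import Function.Bundles using (Equivalence)
open import Relation.Binary.PropositionalEquality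
open import Relation.Nullary using (¬_; yes; no)
open import Relation.Nullary.Decidable using (dec-true)
open import Relation.Unary using (Decidable)

-- `k` is fixed first, and the target for all large `n` is the bound with `-1/[1+ k ]` in place of
-- o(1); `diagonalise` then lets `k` grow with `n`. With `q` = 4k + 4 and `w` = q - 1, the ε of the
-- overview is 1/q, and the estimates together lose four factors `q / w`, which the factor 1 -
-- 1/(k+1) pays for. The logarithm occurs only on the smaller side of the claim, so upper bounds for
-- it suffice, and they all come from ln (q/w) ≤ 1/w. The remaining estimates compare powers of `q`
-- and `w` in `ℕ`: the base `q / w` is the natural one, since (w/q)ᵗ is the probability of missing
-- `t` elements.

private variable
  A B X Y : Set
  a b n   : ℕ

-- Finite sums and averaging.

∑ : List A → (A → ℕ) → ℕ
∑ xs f = sum (map f xs)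

∑-const : ∀ c (xs : List A) → ∑ xs (λ _ → c) ≡ length xs * c
∑-const c []       = refl
∑-const c (_ ∷ xs) = cong (c +_) (∑-const c xs)

∑-+ : ∀ (f g : A → ℕ) xs → ∑ xs (λ x → f x + g x) ≡ ∑ xs f + ∑ xs g
∑-+ f g []       = refl
∑-+ f g (x ∷ xs) = begin
  f x + g x + ∑ xs (λ x → f x + g x)  ≡⟨ cong (f x + g x +_) (∑-+ f g xs) ⟩
  f x + g x + (∑ xs f + ∑ xs g)    ≡⟨ lem (f x) (g x) (∑ xs f) (∑ xs g) ⟩
  f x + ∑ xs f + (g x + ∑ xs g)    ∎
  where
  open ≡-Reasoning
  lem : ∀ a b c d → a + b + (c + d) ≡ a + c + (b + d)
  lem = solve-∀

∑-*ˡ : ∀ c (f : A → ℕ) xs → ∑ xs (λ x → c * f x) ≡ c * ∑ xs f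
∑-*ˡ c f []       = sym (*-zeroʳ c)
∑-*ˡ c f (x ∷ xs) = trans (cong (c * f x +_) (∑-*ˡ c f xs)) (sym (*-distribˡ-+ c (f x) (∑ xs f)))

∑-swap : ∀ (f : X → Y → ℕ) xs ys →
         ∑ xs (λ x → ∑ ys (f x)) ≡ ∑ ys (λ y → ∑ xs (λ x → f x y))
∑-swap f []       ys = sym (trans (∑-const 0 ys) (*-zeroʳ (length ys)))
∑-swap f (x ∷ xs) ys = trans (cong (∑ ys (f x) +_) (∑-swap f xs ys))
  (sym (∑-+ (f x) (λ y → ∑ xs (λ x → f x y)) ys))

∑-mono : ∀ {f g : A → ℕ} {xs} → All (λ x → f x ≤ g x) xs → ∑ xs f ≤ ∑ xs g
∑-mono []       = z≤n
∑-mono (h ∷ hs) = +-mono-≤ h (∑-mono hs)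

average : ∀ (f : A → ℕ) c xs → 0 < length xs → length xs * c ≤ ∑ xs f →
          ∃[ x ] x ∈ᴸ xs × c ≤ f x
average f c (x ∷ xs) _ h with c ≤? f x
... | yes c≤ = x , here refl , c≤
average f c (x ∷ [])          _ h | no c≰ =
  ⊥-elim (c≰ (subst₂ _≤_ (+-identityʳ c) (+-identityʳ (f x)) h))
average f c (x ∷ xs@(_ ∷ _)) _ h | no c≰
  with average f c xs z<s (+-cancelˡ-≤ c _ _
         (≤-trans h (+-monoˡ-≤ _ (≰⇒≥ c≰))))
... | x′ , x′∈ , c≤ = x′ , there x′∈ , c≤

-- Greedy covering.

indicator : Bool → ℕ
indicator b = if b then 1 else 0

count : (A → Bool) → List A → ℕ
count p xs = ∑ xs (indicator ∘ p)

length-filter-not : ∀ (p : A → Bool) xs →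
                    length (filterᵇ (not ∘ p) xs) + count p xs ≡ length xs
length-filter-not p []       = refl
length-filter-not p (x ∷ xs) with p x
... | true  = trans (+-suc _ _) (cong suc (length-filter-not p xs))
... | false = cong suc (length-filter-not p xs)

-- By averaging, some x is related to at least the fraction P / (G + P) of
-- the y that are still uncovered, so each greedy choice multiplies their
-- number by at most G / (G + P).
module Greedy (R : X → Y → Bool) (xs : List X) (nonempty : 0 < length xs) (G P : ℕ) where

  Popular : Y → Set
  Popular y = P * length xs ≤ (G + P) * count (λ x → R x y) xs

  Covered : ∀ {r} → (Fin r → X) → Y → Set
  Covered S y = ∃[ i ] T (R (S i) y)

  best : ∀ ys → All Popular ys →
         ∃[ x ] x ∈ᴸ xs × P * length ys ≤ (G + P) * count (R x) ys
  best ys pop = average (λ x → (G + P) * count (R x) ys) (P * length ys) xs nonempty (begin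
    length xs * (P * length ys)
      ≡⟨ lem (length xs) P (length ys) ⟩
    length ys * (P * length xs)
      ≡⟨ ∑-const (P * length xs) ys ⟨
    ∑ ys (λ _ → P * length xs)
      ≤⟨ ∑-mono pop ⟩
    ∑ ys (λ y → (G + P) * count (λ x → R x y) xs)
      ≡⟨ ∑-*ˡ (G + P) (λ y → count (λ x → R x y) xs) ys ⟩
    (G + P) * ∑ ys (λ y → count (λ x → R x y) xs)
      ≡⟨ cong ((G + P) *_) (∑-swap (λ x y → indicator (R x y)) xs ys) ⟨
    (G + P) * ∑ xs (λ x → count (R x) ys)
      ≡⟨ ∑-*ˡ (G + P) (λ x → count (R x) ys) xs ⟨
    ∑ xs (λ x → (G + P) * count (R x) ys) ∎)
    where
    open ≤-Reasoning
    lem : ∀ a b c → a * (b * c) ≡ c * (b * a)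
    lem = solve-∀

  shrink : ∀ x ys → P * length ys ≤ (G + P) * count (R x) ys →
           length (filterᵇ (not ∘ R x) ys) * (G + P) ≤ G * length ys
  shrink x ys h = +-cancelʳ-≤ (P * length ys) _ _ (begin
    rest * (G + P) + P * length ys          ≤⟨ +-monoʳ-≤ (rest * (G + P)) h ⟩
    rest * (G + P) + (G + P) * hit          ≡⟨ lem rest (G + P) hit ⟩
    (G + P) * (rest + hit)                  ≡⟨ cong ((G + P) *_) (length-filter-not (R x) ys) ⟩
    (G + P) * length ys                     ≡⟨ *-distribʳ-+ (length ys) G P ⟩
    G * length ys + P * length ys           ∎)
    where
    open ≤-Reasoning
    rest hit : ℕ
    rest = length (filterᵇ (not ∘ R x) ys)
    hit  = count (R x) ys
    lem : ∀ a b c → a * b + b * c ≡ b * (a + c)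
    lem = solve-∀

  -- Popularity of `y` refers to all of `xs`, so it survives the removal of covered elements and
  -- every round starts from the same hypothesis. The uncovered rest `zs` is returned with its size,
  -- to be shown empty for large `r`.
  greedy : ∀ r ys → All Popular ys →
           Σ[ S ∈ (Fin r → X) ] Σ[ zs ∈ List Y ]
             (∀ i → S i ∈ᴸ xs) ×
             length zs * (G + P) ^ r ≤ G ^ r * length ys ×
             (∀ {y} → y ∈ᴸ ys → y ∈ᴸ zs ⊎ Covered S y)
  greedy zero ys pop = (λ ()) , ys , (λ ()) ,
    ≤-reflexive (trans (*-identityʳ (length ys)) (sym (+-identityʳ (length ys)))) , inj₁
  greedy (suc r) ys pop with best ys pop
  ... | x , x∈xs , h with greedy r (filterᵇ (not ∘ R x) ys) (All.filter⁺ (T? ∘ not ∘ R x) pop)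
  ... | S , zs , S∈xs , len , cov = S′ , zs , S′∈xs , len′ , cov′
    where
    ys′ : List Y
    ys′ = filterᵇ (not ∘ R x) ys
    S′ : Fin (suc r) → X
    S′ zero    = x
    S′ (suc i) = S i
    S′∈xs : ∀ i → S′ i ∈ᴸ xs
    S′∈xs zero    = x∈xs
    S′∈xs (suc i) = S∈xs i
    len′ : length zs * (G + P) ^ suc r ≤ G ^ suc r * length ys
    len′ = begin
      length zs * ((G + P) * (G + P) ^ r)  ≡⟨ lem₁ (length zs) (G + P) _ ⟩
      (length zs * (G + P) ^ r) * (G + P)  ≤⟨ *-monoˡ-≤ (G + P) len ⟩
      G ^ r * length ys′ * (G + P)         ≡⟨ *-assoc (G ^ r) (length ys′) (G + P) ⟩
      G ^ r * (length ys′ * (G + P))       ≤⟨ *-monoʳ-≤ (G ^ r) (shrink x ys h) ⟩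
      G ^ r * (G * length ys)              ≡⟨ lem₂ (G ^ r) G (length ys) ⟩
      G * G ^ r * length ys                ∎
      where
      open ≤-Reasoning
      lem₁ : ∀ a b c → a * (b * c) ≡ a * c * b
      lem₁ = solve-∀
      lem₂ : ∀ a b c → a * (b * c) ≡ b * a * c
      lem₂ = solve-∀
    cov′ : ∀ {y} → y ∈ᴸ ys → y ∈ᴸ zs ⊎ Covered S′ y
    cov′ {y} y∈ys with R x y in eq
    ... | true  = inj₂ (zero , subst T (sym eq) tt)
    ... | false with cov (∈-filter⁺ (T? ∘ not ∘ R x) y∈ys (subst (T ∘ not) (sym eq) tt))
    ...   | inj₁ y∈zs    = inj₁ y∈zs
    ...   | inj₂ (i , c) = inj₂ (suc i , c)

^-distribʳ-* : ∀ m n o → (m * n) ^ o ≡ m ^ o * n ^ o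
^-distribʳ-* m n zero    = refl
^-distribʳ-* m n (suc o) = trans (cong (m * n *_) (^-distribʳ-* m n o)) (lem m n (m ^ o) (n ^ o))
  where
  lem : ∀ a b c d → a * b * (c * d) ≡ a * c * (b * d)
  lem = solve-∀

-- Bernoulli's inequality for (1 + y/x)^(m+1), cleared of denominators. In the induction the slack
-- is the term in y².
bernoulli : ∀ x y m → x ^ m * (x + suc m * y) ≤ (x + y) ^ suc m
bernoulli x y zero    = ≤-reflexive (lem x y)
  where
  lem : ∀ x y → 1 * (x + 1 * y) ≡ (x + y) * 1
  lem = solve-∀
bernoulli x y (suc m) = begin
  x * x ^ m * (x + suc (suc m) * y)          ≤⟨ m≤m+n _ _ ⟩
  x * x ^ m * (x + suc (suc m) * y) + suc m * y * y * x ^ m ≡⟨ lem x y m (x ^ m) ⟩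
  (x + y) * (x ^ m * (x + suc m * y))        ≤⟨ *-monoʳ-≤ (x + y) (bernoulli x y m) ⟩
  (x + y) * (x + y) ^ suc m                  ∎
  where
  open ≤-Reasoning
  lem : ∀ x y m z → x * z * (x + suc (suc m) * y) + suc m * y * y * z ≡ (x + y) * (z * (x + suc m * y))
  lem = solve-∀

-- By Bernoulli, (1 + P/G)^(h+1) ≥ 1 + (h+1)P/G ≥ 2. So as many rounds as the reciprocal of the
-- hitting probability P/(G+P), rounded up, halve what is uncovered.
halving : ∀ G P h → G + P ≤ suc h * P → 2 * G ^ suc h ≤ (G + P) ^ suc h
halving G P h le = begin
  2 * (G * G ^ h)          ≡⟨ lem G (G ^ h) ⟩
  G ^ h * (G + G)          ≤⟨ *-monoʳ-≤ (G ^ h) (+-monoʳ-≤ G (≤-trans (m≤m+n G P) le)) ⟩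
  G ^ h * (G + suc h * P)  ≤⟨ bernoulli G P h ⟩
  (G + P) ^ suc h          ∎
  where
  open ≤-Reasoning
  lem : ∀ a b → 2 * (a * b) ≡ b * (a + a)
  lem = solve-∀

-- After `s` halvings, fewer than 2^s elements have shrunk to fewer than one, so none is left.
fullCover : ∀ (R : X → Y → Bool) xs → 0 < length xs → ∀ G P h s ys → 0 < P →
            All (λ y → P * length xs ≤ (G + P) * count (λ x → R x y) xs) ys →
            G + P ≤ suc h * P → length ys < 2 ^ s →
            Σ[ S ∈ (Fin (suc h * s) → X) ] (∀ i → S i ∈ᴸ xs) ×
              (∀ {y} → y ∈ᴸ ys → ∃[ i ] T (R (S i) y))
fullCover {X = X} R xs ne G P h s ys 0<P pop le lt
  with Greedy.greedy R xs ne G P (suc h * s) ys pop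
... | S , [] , S∈ , _ , cov = S , S∈ , λ y∈ → case (cov y∈)
  where
  case : ∀ {y} → y ∈ᴸ [] ⊎ (∃[ i ] T (R (S i) y)) → ∃[ i ] T (R (S i) y)
  case (inj₂ c) = c
... | S , z ∷ zs , S∈ , len , cov = ⊥-elim (<-irrefl refl (begin-strict
  2 ^ s * G ^ r * length ys   ≤⟨ *-monoˡ-≤ (length ys) pow ⟩
  Q ^ r * length ys           <⟨ *-monoʳ-< (Q ^ r) {{Q^r≢0}} lt ⟩
  Q ^ r * 2 ^ s               ≡⟨ *-comm (Q ^ r) (2 ^ s) ⟩
  2 ^ s * Q ^ r               ≤⟨ *-monoʳ-≤ (2 ^ s) (m≤m+n (Q ^ r) (length zs * Q ^ r)) ⟩
  2 ^ s * (suc (length zs) * Q ^ r)  ≤⟨ *-monoʳ-≤ (2 ^ s) len ⟩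
  2 ^ s * (G ^ r * length ys) ≡⟨ *-assoc (2 ^ s) (G ^ r) (length ys) ⟨
  2 ^ s * G ^ r * length ys   ∎))
  where
  open ≤-Reasoning
  Q r : ℕ
  Q = G + P
  r = suc h * s
  Q^r≢0 : NonZero (Q ^ r)
  Q^r≢0 = m^n≢0 Q r {{>-nonZero (≤-trans 0<P (m≤n+m P G))}}
  pow : 2 ^ s * G ^ r ≤ Q ^ r
  pow = begin
    2 ^ s * G ^ r             ≡⟨ cong (2 ^ s *_) (^-*-assoc G (suc h) s) ⟨
    2 ^ s * (G ^ suc h) ^ s   ≡⟨ ^-distribʳ-* 2 (G ^ suc h) s ⟨
    (2 * G ^ suc h) ^ s       ≤⟨ ^-monoˡ-≤ s (halving G P h le) ⟩
    (Q ^ suc h) ^ s           ≡⟨ ^-*-assoc Q (suc h) s ⟩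
    Q ^ r                     ∎

∑-++ : ∀ (f : A → ℕ) xs ys → ∑ (xs ++ ys) f ≡ ∑ xs f + ∑ ys f
∑-++ f xs ys = trans (cong sum (map-++ f xs ys)) (sum-++ (map f xs) (map f ys))

∑-map : ∀ (f : B → ℕ) (g : A → B) xs → ∑ (map g xs) f ≡ ∑ xs (f ∘ g)
∑-map f g xs = cong sum (sym (map-∘ xs))

-- Counting subsets

disjoint : Subset a → Subset a → Bool
disjoint []            []            = true
disjoint (inside  ∷ U) (inside  ∷ V) = false
disjoint (inside  ∷ U) (outside ∷ V) = disjoint U V
disjoint (outside ∷ U) (_       ∷ V) = disjoint U V

disjoint-sound : ∀ (U V : Subset a) → T (disjoint U V) → ∀ {x} → x ∈ U → x ∈ V → ⊥
disjoint-sound (inside  ∷ U) (outside ∷ V) d (there x∈U) (there x∈V) = disjoint-sound U V d x∈U x∈V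
disjoint-sound (outside ∷ U) (_       ∷ V) d (there x∈U) (there x∈V) = disjoint-sound U V d x∈U x∈V

-- Enumerated along Pascal's rule rather than by filtering all subsets, so that counts become
-- binomial coefficients by the same recursion.
ofSize : ∀ a → ℕ → List (Subset a)
ofSize a       zero    = Subset.⊥ ∷ []
ofSize zero    (suc d) = []
ofSize (suc a) (suc d) = map (outside ∷_) (ofSize a (suc d)) ++ map (inside ∷_) (ofSize a d)

ofSize-size : ∀ a d → All (λ S → ∣ S ∣ ≡ d) (ofSize a d)
ofSize-size a       zero    = ∣⊥∣≡0 a ∷ []
ofSize-size zero    (suc d) = []
ofSize-size (suc a) (suc d) = All.++⁺
  (All.map⁺ (ofSize-size a (suc d)))
  (All.map⁺ (All.map (cong suc) (ofSize-size a d)))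

nC0≡1 : ∀ n → n C 0 ≡ 1
nC0≡1 zero    = refl
nC0≡1 (suc n) = refl

disjoint-⊥ : ∀ (U : Subset a) → disjoint Subset.⊥ U ≡ true
disjoint-⊥ []      = refl
disjoint-⊥ (_ ∷ U) = disjoint-⊥ U

length-ofSize : ∀ a d → length (ofSize a d) ≡ a C d
length-ofSize zero    zero    = refl
length-ofSize (suc a) zero    = refl
length-ofSize zero    (suc d) = refl
length-ofSize (suc a) (suc d) = begin
  length (map (outside ∷_) (ofSize a (suc d)) ++ map (inside ∷_) (ofSize a d))
    ≡⟨ length-++ (map (outside ∷_) (ofSize a (suc d))) ⟩
  length (map (outside ∷_) (ofSize a (suc d))) + length (map (inside ∷_) (ofSize a d))
    ≡⟨ cong₂ _+_ (length-map _ (ofSize a (suc d))) (length-map _ (ofSize a d)) ⟩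
  length (ofSize a (suc d)) + length (ofSize a d)
    ≡⟨ cong₂ _+_ (length-ofSize a (suc d)) (length-ofSize a d) ⟩
  a C suc d + a C d
    ≡⟨ +-comm (a C suc d) (a C d) ⟩
  a C d + a C suc d
    ≡⟨ nCk+nC[k+1]≡[n+1]C[k+1] a d ⟩
  suc a C suc d ∎
  where open ≡-Reasoning

-- A coordinate outside `U` leaves both branches of `ofSize` and gives Pascal's rule for `∁ U`; a
-- coordinate in `U` kills the branch `inside`.
count-disjoint : ∀ d (U : Subset a) → count (λ S → disjoint S U) (ofSize a d) ≡ ∣ ∁ U ∣ C d
count-disjoint {a} zero U rewrite disjoint-⊥ U = sym (nC0≡1 ∣ ∁ U ∣)
count-disjoint (suc d) []            = refl
count-disjoint {suc a} (suc d) (s ∷ U) = begin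
  count f (map (outside ∷_) (ofSize a (suc d)) ++ map (inside ∷_) (ofSize a d))
    ≡⟨ ∑-++ (indicator ∘ f) (map (outside ∷_) (ofSize a (suc d))) _ ⟩
  count f (map (outside ∷_) (ofSize a (suc d))) + count f (map (inside ∷_) (ofSize a d))
    ≡⟨ cong₂ _+_ (∑-map (indicator ∘ f) (outside ∷_) (ofSize a (suc d)))
                 (∑-map (indicator ∘ f) (inside ∷_) (ofSize a d)) ⟩
  count (λ S → disjoint S U) (ofSize a (suc d)) + count (f ∘ (inside ∷_)) (ofSize a d)
    ≡⟨ cong (_+ count (f ∘ (inside ∷_)) (ofSize a d)) (count-disjoint (suc d) U) ⟩
  ∣ ∁ U ∣ C suc d + count (f ∘ (inside ∷_)) (ofSize a d)
    ≡⟨ head s ⟩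
  ∣ ∁ (s ∷ U) ∣ C suc d ∎
  where
  open ≡-Reasoning
  f : Subset (suc a) → Bool
  f S = disjoint S (s ∷ U)
  head : ∀ s → ∣ ∁ U ∣ C suc d + count (λ S → disjoint (inside ∷ S) (s ∷ U)) (ofSize a d)
             ≡ ∣ ∁ (s ∷ U) ∣ C suc d
  head inside  = trans (cong (∣ ∁ U ∣ C suc d +_)
    (trans (∑-const 0 (ofSize a d)) (*-zeroʳ (length (ofSize a d))))) (+-identityʳ _)
  head outside = trans (cong (∣ ∁ U ∣ C suc d +_) (count-disjoint d U))
    (trans (+-comm (∣ ∁ U ∣ C suc d) (∣ ∁ U ∣ C d)) (nCk+nC[k+1]≡[n+1]C[k+1] ∣ ∁ U ∣ d))

-- Both sides count pairs of a k-subset and an element of an n-set: the element lies outside the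
-- subset (first summand) or inside it (second). The proof is induction by Pascal's rule.
[1+k]*nC[1+k]+k*nCk≡n*nCk : ∀ n k → suc k * (n C suc k) + k * (n C k) ≡ n * (n C k)
[1+k]*nC[1+k]+k*nCk≡n*nCk zero k rewrite *-zeroʳ k with k
... | zero  = refl
... | suc k = *-zeroʳ k
[1+k]*nC[1+k]+k*nCk≡n*nCk (suc n) zero
  rewrite sym (nCk+nC[k+1]≡[n+1]C[k+1] n 0) | nC0≡1 n
  = trans (lem (n C 1)) (trans (cong suc ([1+k]*nC[1+k]+k*nCk≡n*nCk n 0)) (lem′ n (nC0≡1 n)))
  where
  lem : ∀ x → suc (x + 0) + 0 ≡ suc (x + 0 + 0)
  lem = solve-∀
  lem′ : ∀ n → n C 0 ≡ 1 → suc (n * (n C 0)) ≡ suc (n * 1)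
  lem′ n e = cong (λ x → suc (n * x)) e
[1+k]*nC[1+k]+k*nCk≡n*nCk (suc n) (suc k)
  rewrite sym (nCk+nC[k+1]≡[n+1]C[k+1] n (suc k)) | sym (nCk+nC[k+1]≡[n+1]C[k+1] n k) = begin
  suc (suc k) * (y + z) + suc k * (x + y)
    ≡⟨ lem₁ k x y z ⟩
  (suc (suc k) * z + suc k * y) + (suc k * y + k * x) + (x + y)
    ≡⟨ cong₂ (λ u v → u + v + (x + y)) ([1+k]*nC[1+k]+k*nCk≡n*nCk n (suc k))
                                       ([1+k]*nC[1+k]+k*nCk≡n*nCk n k) ⟩
  n * y + n * x + (x + y)
    ≡⟨ lem₂ n x y ⟩
  suc n * (x + y) ∎
  where
  open ≡-Reasoning
  x y z : ℕ
  x = n C k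
  y = n C suc k
  z = n C suc (suc k)
  lem₁ : ∀ k x y z → suc (suc k) * (y + z) + suc k * (x + y)
       ≡ (suc (suc k) * z + suc k * y) + (suc k * y + k * x) + (x + y)
  lem₁ = solve-∀
  lem₂ : ∀ n x y → n * y + n * x + (x + y) ≡ suc n * (x + y)
  lem₂ = solve-∀

-- Because C(n+1,d) / C(n,d) = (n+1) / (n+1-d).
C-ratio : ∀ w n d → suc w * d ≤ suc n → w * (suc n C d) ≤ suc w * (n C d)
C-ratio w n zero h rewrite nC0≡1 n = *-monoˡ-≤ 1 (n≤1+n w)
C-ratio w n (suc k) h rewrite sym (nCk+nC[k+1]≡[n+1]C[k+1] n k) = begin
  w * (x + y)        ≡⟨ *-distribˡ-+ w x y ⟩
  w * x + w * y      ≤⟨ +-monoˡ-≤ (w * y) wx≤y ⟩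
  y + w * y          ∎
  where
  open ≤-Reasoning
  x y : ℕ
  x = n C k
  y = n C suc k
  wx≤y : w * x ≤ y
  wx≤y = *-cancelˡ-≤ (suc k) (+-cancelʳ-≤ (k * x) _ _ (begin
    suc k * (w * x) + k * x   ≡⟨ lem k w x ⟩
    (w * suc k + k) * x       ≤⟨ *-monoˡ-≤ x (s≤s⁻¹ (≤-trans (≤-reflexive (lem′ w k)) h)) ⟩
    n * x                     ≡⟨ [1+k]*nC[1+k]+k*nCk≡n*nCk n k ⟨
    suc k * y + k * x         ∎))
    where
    lem : ∀ k w x → suc k * (w * x) + k * x ≡ (w * suc k + k) * x
    lem = solve-∀
    lem′ : ∀ w k → suc (w * suc k + k) ≡ suc w * suc k
    lem′ = solve-∀

C-ratio^ : ∀ w e m d → suc w * d ≤ suc m → w ^ e * ((e + m) C d) ≤ suc w ^ e * (m C d)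
C-ratio^ w zero    m d h = ≤-refl
C-ratio^ w (suc e) m d h = begin
  w * w ^ e * (suc (e + m) C d)        ≡⟨ lem w (w ^ e) (suc (e + m) C d) ⟩
  w ^ e * (w * (suc (e + m) C d))      ≤⟨ *-monoʳ-≤ (w ^ e) (C-ratio w (e + m) d (≤-trans h (s≤s (m≤n+m m e)))) ⟩
  w ^ e * (suc w * ((e + m) C d))      ≡⟨ lem′ (w ^ e) (suc w) ((e + m) C d) ⟩
  suc w * (w ^ e * ((e + m) C d))      ≤⟨ *-monoʳ-≤ (suc w) (C-ratio^ w e m d h) ⟩
  suc w * (suc w ^ e * (m C d))        ≡⟨ *-assoc (suc w) (suc w ^ e) (m C d) ⟨
  suc w * suc w ^ e * (m C d)          ∎
  where
  open ≤-Reasoning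
  lem : ∀ a b c → a * b * c ≡ b * (a * c)
  lem = solve-∀
  lem′ : ∀ a b c → a * (b * c) ≡ b * (a * c)
  lem′ = solve-∀

∣U∣+∣∁U∣ : ∀ (U : Subset a) → ∣ U ∣ + ∣ ∁ U ∣ ≡ a
∣U∣+∣∁U∣ U = trans (cong (∣ U ∣ +_) (∣∁p∣≡n∸∣p∣ U)) (m+[n∸m]≡n (∣p∣≤n U))

-- The hypergeometric probability of missing `U` is a product of one factor for each element of `U`.
-- Each factor is at least `w / suc w` as long as `d` is at most the fraction 1/(w+1) of what
-- remains, which `suc w * d + t ≤ a` guarantees to the end. If `U` has fewer than `t` elements, the
-- missing factors are padded by `w ≤ suc w`.
miss-fraction : ∀ w t d (U : Subset a) → ∣ U ∣ ≤ t → suc w * d + t ≤ a →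
  w ^ t * length (ofSize a d) ≤ suc w ^ t * count (λ S → disjoint S U) (ofSize a d)
miss-fraction {a} w t d U U≤t h = begin
  w ^ t * length (ofSize a d)
    ≡⟨ cong₂ (λ i j → w ^ i * j) t≡ (trans (length-ofSize a d) (cong (_C d) (sym (∣U∣+∣∁U∣ U)))) ⟩
  w ^ (e + τ) * ((τ + m) C d)
    ≡⟨ cong (_* ((τ + m) C d)) (^-distribˡ-+-* w e τ) ⟩
  w ^ e * w ^ τ * ((τ + m) C d)
    ≡⟨ *-assoc (w ^ e) (w ^ τ) _ ⟩
  w ^ e * (w ^ τ * ((τ + m) C d))
    ≤⟨ *-mono-≤ (^-monoˡ-≤ e (n≤1+n w)) (C-ratio^ w τ m d (m≤n⇒m≤1+n qd≤m)) ⟩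
  suc w ^ e * (suc w ^ τ * (m C d))
    ≡⟨ *-assoc (suc w ^ e) (suc w ^ τ) _ ⟨
  suc w ^ e * suc w ^ τ * (m C d)
    ≡⟨ cong (_* (m C d)) (^-distribˡ-+-* (suc w) e τ) ⟨
  suc w ^ (e + τ) * (m C d)
    ≡⟨ cong₂ (λ i j → suc w ^ i * j) t≡ (count-disjoint d U) ⟨
  suc w ^ t * count (λ S → disjoint S U) (ofSize a d) ∎
  where
  open ≤-Reasoning
  τ m e : ℕ
  τ = ∣ U ∣
  m = ∣ ∁ U ∣
  e = t ∸ τ
  t≡ : t ≡ e + τ
  t≡ = sym (m∸n+n≡m U≤t)
  qd≤m : suc w * d ≤ m
  qd≤m = +-cancelˡ-≤ τ _ _ (begin
    τ + suc w * d   ≤⟨ +-monoˡ-≤ (suc w * d) U≤t ⟩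
    t + suc w * d   ≡⟨ +-comm t (suc w * d) ⟩
    suc w * d + t   ≤⟨ h ⟩
    a               ≡⟨ ∣U∣+∣∁U∣ U ⟨
    τ + m           ∎)

-- Sizes below `t` are included because the part of a candidate dominating set inside `Fin a` can be
-- smaller than the set itself.
smallSubsets : ∀ a → ℕ → List (Subset a)
smallSubsets zero    t       = [] ∷ []
smallSubsets (suc a) zero    = map (outside ∷_) (smallSubsets a zero)
smallSubsets (suc a) (suc t) = map (outside ∷_) (smallSubsets a (suc t)) ++ map (inside ∷_) (smallSubsets a t)

smallSubsets-size : ∀ a t → All (λ S → ∣ S ∣ ≤ t) (smallSubsets a t)
smallSubsets-size zero    t       = z≤n ∷ []
smallSubsets-size (suc a) zero    = All.map⁺ (smallSubsets-size a zero)
smallSubsets-size (suc a) (suc t) = All.++⁺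
  (All.map⁺ (smallSubsets-size a (suc t)))
  (All.map⁺ (All.map s≤s (smallSubsets-size a t)))

smallSubsets-complete : ∀ t (S : Subset a) → ∣ S ∣ ≤ t → S ∈ᴸ smallSubsets a t
smallSubsets-complete t       []            _       = here refl
smallSubsets-complete zero    (outside ∷ S) h       = ∈-map⁺ (outside ∷_) (smallSubsets-complete zero S h)
smallSubsets-complete (suc t) (outside ∷ S) h       =
  ∈-++⁺ˡ (∈-map⁺ (outside ∷_) (smallSubsets-complete (suc t) S h))
smallSubsets-complete {suc a} (suc t) (inside ∷ S) (s≤s h) =
  ∈-++⁺ʳ (map (outside ∷_) (smallSubsets a (suc t))) (∈-map⁺ (inside ∷_) (smallSubsets-complete t S h))

-- A set of at most `t` elements is described by `t` choices from `Fin a` and a blank. The crudeness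
-- is harmless: only the logarithm of this bound enters the number of rounds.
length-smallSubsets : ∀ a t → length (smallSubsets a t) ≤ suc a ^ t
length-smallSubsets zero    t       = ≤-reflexive (sym (^-zeroˡ t))
length-smallSubsets (suc a) zero    = ≤-trans
  (≤-reflexive (length-map _ (smallSubsets a zero))) (length-smallSubsets a zero)
length-smallSubsets (suc a) (suc t) = begin
  length (map (outside ∷_) (smallSubsets a (suc t)) ++ map (inside ∷_) (smallSubsets a t))
    ≡⟨ length-++ (map (outside ∷_) (smallSubsets a (suc t))) ⟩
  length (map (outside ∷_) (smallSubsets a (suc t))) + length (map (inside ∷_) (smallSubsets a t))
    ≡⟨ cong₂ _+_ (length-map _ (smallSubsets a (suc t))) (length-map _ (smallSubsets a t)) ⟩
  length (smallSubsets a (suc t)) + length (smallSubsets a t)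
    ≤⟨ +-mono-≤ (length-smallSubsets a (suc t)) (length-smallSubsets a t) ⟩
  suc a * suc a ^ t + suc a ^ t
    ≡⟨ +-comm (suc a * suc a ^ t) (suc a ^ t) ⟩
  suc (suc a) * suc a ^ t
    ≤⟨ *-monoʳ-≤ (suc (suc a)) (^-monoˡ-≤ t (n≤1+n (suc a))) ⟩
  suc (suc a) * suc (suc a) ^ t ∎
  where open ≤-Reasoning

C>0 : ∀ n d → d ≤ n → 0 < n C d
C>0 n       zero    _       = ≤-reflexive (sym (nC0≡1 n))
C>0 (suc n) (suc d) (s≤s h) = ≤-trans (C>0 n d h)
  (≤-trans (m≤m+n (n C d) (n C suc d)) (≤-reflexive (nCk+nC[k+1]≡[n+1]C[k+1] n d)))

-- A greedy cover, where S covers U when they are disjoint.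
missingFamily : ∀ w t d u h → .{{NonZero w}} → .{{NonZero t}} → suc w * d + t ≤ a → suc a < 2 ^ u →
  suc w ^ t ≤ suc h * w ^ t →
  Σ[ S ∈ (Fin (suc h * (u * t)) → Subset a) ] (∀ i → ∣ S i ∣ ≡ d) ×
    (∀ U → ∣ U ∣ ≤ t → ∃[ i ] T (disjoint (S i) U))
missingFamily {a} w t d u h fit a<2^u ratio
  -- `G` and `P` are chosen so that P/(G+P) is the missing probability (w/q)ᵗ, and 2^(u*t) exceeds
  -- the number of sets to be covered.
  with fullCover disjoint (ofSize a d) nonempty (q ^ t ∸ w ^ t) (w ^ t) h (u * t) (smallSubsets a t)
         (m^n>0 w t)
         (All.map (λ {U} U≤t → subst (λ Q → w ^ t * length (ofSize a d) ≤ Q * count (λ S → disjoint S U) (ofSize a d))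
            (sym split) (miss-fraction w t d U U≤t fit)) (smallSubsets-size a t))
         (≤-trans (≤-reflexive split) ratio)
         (≤-<-trans (length-smallSubsets a t) (subst (suc a ^ t <_) (^-*-assoc 2 u t) (^-monoˡ-< t a<2^u)))
  where
  q : ℕ
  q = suc w
  split : q ^ t ∸ w ^ t + w ^ t ≡ q ^ t
  split = m∸n+n≡m (^-monoˡ-≤ t (n≤1+n w))
  nonempty : 0 < length (ofSize a d)
  nonempty = subst (0 <_) (sym (length-ofSize a d))
    (C>0 a d (≤-trans (m≤n*m d q) (≤-trans (m≤m+n (q * d) t) fit)))
... | S , S∈ , cov = S , (λ i → All.lookup (ofSize-size a d) (S∈ i)) ,
  λ U U≤t → cov (smallSubsets-complete t U U≤t)

-- The graphs

∣tabulate∣-lower : ∀ (p : Subset a) (f : Fin (a + b) → Bool) →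
                   (∀ {x} → x ∈ p → f (x ↑ˡ b) ≡ true) → ∣ p ∣ ≤ ∣ tabulate f ∣
∣tabulate∣-lower []            f h = z≤n
∣tabulate∣-lower (inside  ∷ p) f h rewrite h here = s≤s (∣tabulate∣-lower p (f ∘ suc) (h ∘ there))
∣tabulate∣-lower (outside ∷ p) f h with f zero
... | true  = m≤n⇒m≤1+n (∣tabulate∣-lower p (f ∘ suc) (h ∘ there))
... | false = ∣tabulate∣-lower p (f ∘ suc) (h ∘ there)

-- Meant for codegrees: in the complement a vertex of `Fin a` is joined to its own part except to
-- itself. Hence the `suc` here and the strict inequality `p>d` in `Degrees`.
∣tabulate∣-lower-except : ∀ y (p : Subset a) (f : Fin (a + b) → Bool) →
  (∀ {x} → x ∈ p → x ≢ y → f (x ↑ˡ b) ≡ true) → ∣ p ∣ ≤ suc ∣ tabulate f ∣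
∣tabulate∣-lower-except {suc a} {b} zero (s ∷ p) f h = ≤-trans (head s) (s≤s (tail (f zero)))
  where
  rest : ∣ p ∣ ≤ ∣ tabulate (f ∘ suc) ∣
  rest = ∣tabulate∣-lower {b = b} p (f ∘ suc) (λ x∈p → h (there x∈p) λ ())
  head : ∀ s → ∣ s ∷ p ∣ ≤ suc ∣ p ∣
  head inside  = ≤-refl
  head outside = n≤1+n _
  tail : ∀ c → ∣ p ∣ ≤ ∣ c ∷ tabulate (f ∘ suc) ∣
  tail inside  = m≤n⇒m≤1+n rest
  tail outside = rest
∣tabulate∣-lower-except (suc y) (inside ∷ p) f h rewrite h here (λ ()) =
  s≤s (∣tabulate∣-lower-except y p (f ∘ suc) λ x∈p x≢y → h (there x∈p) (x≢y ∘ Fin.suc-injective))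
∣tabulate∣-lower-except (suc y) (outside ∷ p) f h with f zero
... | true  = m≤n⇒m≤1+n (∣tabulate∣-lower-except y p (f ∘ suc) λ x∈p x≢y → h (there x∈p) (x≢y ∘ Fin.suc-injective))
... | false = ∣tabulate∣-lower-except y p (f ∘ suc) λ x∈p x≢y → h (there x∈p) (x≢y ∘ Fin.suc-injective)

injection⇒≤∣p∣ : ∀ {m} (f : Fin m → Fin n) → (∀ {i j} → f i ≡ f j → i ≡ j) →
                 ∀ p → (∀ i → f i ∈ p) → m ≤ ∣ p ∣
injection⇒≤∣p∣ {m = zero}  f inj p f∈p = z≤n
injection⇒≤∣p∣ {m = suc m} f inj p f∈p = ≤-<-trans
  (injection⇒≤∣p∣ (f ∘ suc) (Fin.suc-injective ∘ inj) (p - f zero)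
    λ i → x∈p∧x≢y⇒x∈p-y (f∈p (suc i)) λ eq → Fin.0≢1+n (inj (sym eq)))
  (x∈p⇒∣p-x∣<∣p∣ (f∈p zero))

subsetOfSize : ∀ {k n} → k ≤ n → ∃[ p ] ∣_∣ {n} p ≡ k
subsetOfSize {n = n} z≤n = Subset.⊥ , ∣⊥∣≡0 n
subsetOfSize (s≤s k≤n) with subsetOfSize k≤n
... | p , eq = inside ∷ p , cong suc eq

≤-degree : ∀ (G : Graph (a + b)) u (p : Subset a) →
           (∀ {x} → x ∈ p → Adj G u (x ↑ˡ b)) → ∣ p ∣ ≤ degree G u
≤-degree {b = b} G u p h = ∣tabulate∣-lower {b = b} p _ λ x∈p → dec-true (adj? G u _) (h x∈p)

≤-degree-except : ∀ (G : Graph (a + b)) u y (p : Subset a) →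
                  (∀ {x} → x ∈ p → x ≢ y → Adj G u (x ↑ˡ b)) → ∣ p ∣ ≤ suc (degree G u)
≤-degree-except {b = b} G u y p h =
  ∣tabulate∣-lower-except {b = b} y p _ λ x∈p x≢y → dec-true (adj? G u _) (h x∈p x≢y)

≤-δ : ∀ (G : Graph n) {d} → d ≤ n → (∀ u → d ≤ degree G u) → d ≤ δ G
≤-δ {n} G d≤n h = v≤min⁺ d≤n (All.map⁺ (All.universal h (allFin n)))

-- A global dominating set dominates `G`, so bounding the dominating sets of `G` is enough; `t < n`
-- deals with the default value of the minimum.
<-γg : ∀ (G : Graph n) {t} → t < n → (∀ X → Dominating G X → t < ∣ X ∣) → t < γg G
<-γg {n} G t<n h = v≤min⁺ t<n (All.map⁺
  (All.map (λ {X} dom → h X (proj₁ dom)) (All.all-filter (globalDominating? G) (subsets n))))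

∈-∁ : ∀ (p : Subset n) {x} → x ∈ ∁ p → lookup p x ≡ false
∈-∁ p {x} x∈ = not-injective (trans (sym (lookup-map x not p)) ([]=⇒lookup x∈))

-- A complete bipartite graph on Fin a with parts p and ∁ p, and an independent set Fin b
-- in which j is joined to the members of S j.
module Construction {a b} (p : Subset a) (S : Fin b → Subset a) where

  edge : Fin a ⊎ Fin b → Fin a ⊎ Fin b → Bool
  edge (inj₁ x) (inj₁ y) = lookup p x xor lookup p y
  edge (inj₁ x) (inj₂ j) = lookup (S j) x
  edge (inj₂ j) (inj₁ x) = lookup (S j) x
  edge (inj₂ _) (inj₂ _) = false

  edge-comm : ∀ u v → edge u v ≡ edge v u
  edge-comm (inj₁ x) (inj₁ y) = xor-comm (lookup p x) (lookup p y)
  edge-comm (inj₁ _) (inj₂ _) = refl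
  edge-comm (inj₂ _) (inj₁ _) = refl
  edge-comm (inj₂ _) (inj₂ _) = refl

  edge-irrefl : ∀ u → edge u u ≡ false
  edge-irrefl (inj₁ x) = xor-same (lookup p x)
  edge-irrefl (inj₂ _) = refl

  graph : Graph (a + b)
  graph .Adj u v = T (edge (splitAt a u) (splitAt a v))
  graph .adj? u v = T? (edge (splitAt a u) (splitAt a v))
  graph .symm {u} {v} = subst T (edge-comm (splitAt a u) (splitAt a v))
  graph .irrefl {u} refl = subst T (edge-irrefl (splitAt a u))

  part : Bool → Subset a
  part c = if c then p else ∁ p

  ∈-part : ∀ c {x} → x ∈ part c → lookup p x ≡ c
  ∈-part true  x∈ = []=⇒lookup x∈
  ∈-part false x∈ = ∈-∁ p x∈

  edge⇒adj : ∀ u x → edge (splitAt a u) (inj₁ x) ≡ true → Adj graph u (x ↑ˡ b)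
  edge⇒adj u x e rewrite splitAt-↑ˡ a x b | e = _

  nonEdge⇒nonAdj : ∀ u x → edge (splitAt a u) (inj₁ x) ≡ false → ¬ Adj graph u (x ↑ˡ b)
  nonEdge⇒nonAdj u x e rewrite splitAt-↑ˡ a x b | e = λ ()

  -- All neighbours counted lie in `Fin a`. A vertex of `Fin a` finds them in the opposite part, and
  -- its non-neighbours in its own; a vertex `j` of `Fin b` finds them in `S j` and `∁ (S j)`.
  module Degrees {d} (p>d : ∀ c → d < ∣ part c ∣)
                 (S-size : ∀ j → ∣ S j ∣ ≡ d) (∁S-size : ∀ j → d ≤ ∣ ∁ (S j) ∣) where

    degree-≥ : ∀ u → d ≤ degree graph u
    degree-≥ u = go (splitAt a u) refl
      where
      xor-not : ∀ c → c xor not c ≡ true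
      xor-not true  = refl
      xor-not false = refl
      go : ∀ v → splitAt a u ≡ v → d ≤ degree graph u
      go (inj₁ y) eq = ≤-trans (<⇒≤ (p>d (not c))) (≤-degree graph u (part (not c))
        λ {x} x∈ → edge⇒adj u x (trans (cong (λ v → edge v (inj₁ x)) eq)
          (trans (cong (c xor_) (∈-part _ x∈)) (xor-not c))))
        where
        c : Bool
        c = lookup p y
      go (inj₂ j) eq = ≤-trans (≤-reflexive (sym (S-size j))) (≤-degree graph u (S j)
        λ {x} x∈ → edge⇒adj u x (trans (cong (λ v → edge v (inj₁ x)) eq) ([]=⇒lookup x∈)))

    codegree-≥ : ∀ u → d ≤ degree (complement graph) u
    codegree-≥ u = go (splitAt a u) refl
      where
      distinct : ∀ {v} x → splitAt a u ≡ v → inj₁ x ≢ v → u ≢ x ↑ˡ b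
      distinct x eq x≢v u≡x =
        x≢v (trans (sym (splitAt-↑ˡ a x b)) (trans (cong (splitAt a) (sym u≡x)) eq))
      nonAdj : ∀ {v} x → splitAt a u ≡ v → edge v (inj₁ x) ≡ false → ¬ Adj graph u (x ↑ˡ b)
      nonAdj x eq e = nonEdge⇒nonAdj u x (trans (cong (λ v → edge v (inj₁ x)) eq) e)
      go : ∀ v → splitAt a u ≡ v → d ≤ degree (complement graph) u
      go (inj₁ y) eq = s≤s⁻¹ (≤-trans (p>d c)
        (≤-degree-except (complement graph) u y (part c) λ {x} x∈ x≢y →
          distinct x eq (x≢y ∘ inj₁-injective) ,
          nonAdj x eq (trans (cong (c xor_) (∈-part _ x∈)) (xor-same c))))
        where
        c : Bool
        c = lookup p y
      go (inj₂ j) eq = ≤-trans (∁S-size j) (≤-degree (complement graph) u (∁ (S j))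
        λ {x} x∈ → distinct x eq (λ ()) , nonAdj x eq (∈-∁ (S j) x∈))

    δ′-≥ : d ≤ a + b → d ≤ δ′ graph
    δ′-≥ d≤ = ⊓-glb (≤-δ graph d≤ degree-≥) (≤-δ (complement graph) d≤ codegree-≥)

trace : ∀ a {b} → Subset (a + b) → Subset a
trace a {b} X = tabulate λ x → lookup X (x ↑ˡ b)

∈-trace : ∀ {a b} (X : Subset (a + b)) {x} → x ↑ˡ b ∈ X → x ∈ trace a X
∈-trace {a} {b} X {x} x∈X = lookup⇒[]= x (trace a X)
  (trans (lookup∘tabulate _ x) ([]=⇒lookup x∈X))

∣trace∣≤ : ∀ a {b} (X : Subset (a + b)) → ∣ trace a X ∣ ≤ ∣ X ∣
∣trace∣≤ a {b} X = ≤-trans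
  (∣tabulate∣-lower {b = b} (trace a X) (lookup X)
    λ {x} x∈ → trans (sym (lookup∘tabulate _ x)) ([]=⇒lookup x∈))
  (≤-reflexive (cong ∣_∣ (tabulate∘lookup X)))

-- Every S i is given to t + 1 vertices, so that a set of size t cannot contain all of them.
module Copies {a r t} (p : Subset a) (S : Fin r → Subset a)
              (dodge : ∀ U → ∣ U ∣ ≤ t → ∃[ i ] T (disjoint (S i) U)) where

  copies : Fin (r * suc t) → Subset a
  copies v = S (proj₁ (remQuot (suc t) v))

  open Construction p copies public

  -- Since `Fin b` is independent, a new vertex can only be dominated from the trace of `X` on
  -- `Fin a`. If `S i` avoids that trace, all copies of `S i` must belong to `X` themselves.
  dominating-size : ∀ X → Dominating graph X → t < ∣ X ∣
  dominating-size X dom = ≰⇒> λ X≤t → contra X≤t (dodge (trace a X) (≤-trans (∣trace∣≤ a X) X≤t))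
    where
    contra : ∣ X ∣ ≤ t → ¬ (∃[ i ] T (disjoint (S i) (trace a X)))
    contra X≤t (i , dis) = <⇒≱ (injection⇒≤∣p∣ copy copy-injective X copy∈X) X≤t
      where
      copy : Fin (suc t) → Fin (a + r * suc t)
      copy j = a ↑ʳ combine i j
      copy-injective : ∀ {j k} → copy j ≡ copy k → j ≡ k
      copy-injective {j} {k} eq = combine-injectiveʳ i j i k (↑ʳ-injective a _ _ eq)
      isolated : ∀ j {u} → u ∈ X → ∀ v → splitAt a u ≡ v → ¬ T (edge (inj₂ (combine i j)) v)
      isolated j u∈X (inj₁ x) eq e = disjoint-sound (S i) (trace a X) dis
        (lookup⇒[]= x (S i) (trans (cong (λ v → lookup (S (proj₁ v)) x) (sym (remQuot-combine i j)))
          (Equivalence.to T-≡ e)))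
        (∈-trace X (subst (_∈ X) (sym (splitAt⁻¹-↑ˡ eq)) u∈X))
      copy∈X : ∀ j → copy j ∈ X
      copy∈X j with copy j ∈? X
      ... | yes c∈X = c∈X
      ... | no  c∉X with dom (copy j) c∉X
      ...   | u , u∈X , adj = ⊥-elim (isolated j u∈X _ refl
              (subst (λ v → T (edge v (splitAt a u))) (splitAt-↑ʳ a _ (combine i j)) adj))

extremalGraph : ∀ {a r t d} (S : Fin r → Subset a) → (∀ i → ∣ S i ∣ ≡ d) →
  (∀ U → ∣ U ∣ ≤ t → ∃[ i ] T (disjoint (S i) U)) →
  suc d + suc d ≤ a → t < a →
  Σ[ G ∈ Graph (a + r * suc t) ] t < γg G × d ≤ δ′ G
-- `p` gets exactly `suc d` elements; the hypothesis leaves at least as many for `∁ p`.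
extremalGraph {a} {r} {t} {d} S S-size dodge 2d+2≤a t<a with subsetOfSize (m+n≤o⇒m≤o (suc d) 2d+2≤a)
... | p , p≡ = graph ,
  <-γg graph (≤-trans t<a (m≤m+n a (r * suc t))) dominating-size ,
  Degrees.δ′-≥ part>d (λ j → S-size _)
    (λ j → subst (λ i → d ≤ i) (sym (∣∁p∣≡n∸∣p∣ (copies j)))
      (subst (λ i → d ≤ a ∸ i) (sym (S-size _)) (m+n≤o⇒m≤o∸n d (≤-trans (+-mono-≤ (n≤1+n d) (n≤1+n d)) 2d+2≤a))))
    (≤-trans (n≤1+n d) (≤-trans (m+n≤o⇒m≤o (suc d) 2d+2≤a) (m≤m+n a (r * suc t))))
  where
  open Copies p S dodge
  part>d : ∀ c → d < ∣ part c ∣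
  part>d true  = ≤-reflexive (sym p≡)
  part>d false = subst (d <_) (sym (∣∁p∣≡n∸∣p∣ p))
    (subst (λ i → suc d ≤ a ∸ i) (sym p≡) (m+n≤o⇒m≤o∸n (suc d) 2d+2≤a))

-- Logarithms

0≤fraction : ∀ i d → 0ℚ ℚ.≤ pos i / suc d
0≤fraction i d = fraction-≤ 0 i 0 d z≤n

harmonic-mono : ∀ {a b} → a ≤ b → harmonic a ℚ.≤ harmonic b
harmonic-mono {a} {b} a≤b = begin
  harmonic a                          ≡⟨ ℚ.+-identityʳ (harmonic a) ⟨
  harmonic a ℚ.+ 0ℚ                   ≤⟨ ℚ.+-monoʳ-≤ (harmonic a) (0≤fraction k (a + k)) ⟩
  harmonic a ℚ.+ pos k / suc (a + k)  ≤⟨ harmonic-lower a k (a + k) (n≤1+n _) ⟩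
  harmonic (k + a)                    ≡⟨ cong harmonic (m∸n+n≡m a≤b) ⟩
  harmonic b                          ∎
  where
  open ℚ.≤-Reasoning
  k : ℕ
  k = b ∸ a

module _ (v : ℕ) where
  private
    w q : ℕ
    w = suc v
    q = suc w

  -- A discrete form of ln (q/w) ≤ 1/w: the difference consists of `c` terms, each at most 1/(w*c +
  -- 1).
  harmonic-ratio : ∀ c → harmonic (q * c) ℚ.≤ harmonic (w * c) ℚ.+ pos 1 / w
  harmonic-ratio c = ℚ.≤-trans (harmonic-upper (w * c) c (w * c) ≤-refl)
    (ℚ.+-monoʳ-≤ (harmonic (w * c)) (fraction-≤ c 1 (w * c) v
      (≤-trans (n≤1+n _) (≤-reflexive (lem v c)))))
    where
    lem : ∀ v c → suc (c * suc v) ≡ 1 * suc (suc v * c)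
    lem = solve-∀

  harmonic-ratio^ : ∀ u c → harmonic (q ^ u * c) ℚ.≤ harmonic (w ^ u * c) ℚ.+ pos u / w
  harmonic-ratio^ zero c = begin
    harmonic (1 * c)                ≡⟨ ℚ.+-identityʳ _ ⟨
    harmonic (1 * c) ℚ.+ 0ℚ         ≤⟨ ℚ.+-monoʳ-≤ (harmonic (1 * c)) (0≤fraction 0 v) ⟩
    harmonic (1 * c) ℚ.+ pos 0 / w  ∎
    where open ℚ.≤-Reasoning
  harmonic-ratio^ (suc u) c = begin
    harmonic (q ^ suc u * c)
      ≡⟨ cong harmonic (lem q (q ^ u) c) ⟩
    harmonic (q ^ u * (q * c))
      ≤⟨ harmonic-ratio^ u (q * c) ⟩
    harmonic (w ^ u * (q * c)) ℚ.+ pos u / w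
      ≡⟨ cong (λ i → harmonic i ℚ.+ pos u / w) (lem′ q (w ^ u) c) ⟩
    harmonic (q * (w ^ u * c)) ℚ.+ pos u / w
      ≤⟨ ℚ.+-monoˡ-≤ (pos u / w) (harmonic-ratio (w ^ u * c)) ⟩
    harmonic (w * (w ^ u * c)) ℚ.+ pos 1 / w ℚ.+ pos u / w
      ≡⟨ cong (λ i → harmonic i ℚ.+ pos 1 / w ℚ.+ pos u / w) (*-assoc w (w ^ u) c) ⟨
    harmonic (w ^ suc u * c) ℚ.+ pos 1 / w ℚ.+ pos u / w
      ≡⟨ swap (harmonic (w ^ suc u * c)) (pos 1 / w) (pos u / w) ⟩
    harmonic (w ^ suc u * c) ℚ.+ (pos u / w ℚ.+ pos 1 / w)
      ≡⟨ cong (λ x → harmonic (w ^ suc u * c) ℚ.+ x) (fraction-suc u v) ⟨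
    harmonic (w ^ suc u * c) ℚ.+ pos (suc u) / w ∎
    where
    open ℚ.≤-Reasoning
    lem : ∀ a b c → a * b * c ≡ b * (a * c)
    lem = solve-∀
    lem′ : ∀ a b c → b * (a * c) ≡ a * (b * c)
    lem′ = solve-∀
    swap : ∀ a b c → a ℚ.+ b ℚ.+ c ≡ a ℚ.+ (c ℚ.+ b)
    swap = +-*-Solver.solve 3 (λ a b c → a :+ b :+ c := a :+ (c :+ b)) refl
      where open +-*-Solver

  -- The sums lnSum m k increase with k, so it suffices to bound them for multiples k of w ^ u,
  -- where the interval splits exactly into u pieces with endpoints in the ratio q / w.
  ln-upper : ∀ m u → suc m * w ^ u ≤ q ^ u → ∀ k → seq (ln (suc m)) k ℚ.≤ pos u / w
  ln-upper m u le k = begin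
    lnSum (suc m) (suc k)
      ≤⟨ LnCauchy.s-mono m (≤⇒≤′ k≤k′) ⟩
    lnSum (suc m) (suc k′)
      ≡⟨ cong (lnSum (suc m)) suc-k′ ⟩
    harmonic (suc m * c) ℚ.- harmonic c
      ≤⟨ ℚ.+-monoˡ-≤ (ℚ.- harmonic c) (ℚ.≤-trans (harmonic-mono mc≤) (harmonic-ratio^ u (suc k))) ⟩
    (harmonic c ℚ.+ pos u / w) ℚ.- harmonic c
      ≡⟨ cancel (harmonic c) (pos u / w) ⟩
    pos u / w ∎
    where
    open ℚ.≤-Reasoning
    c k′ : ℕ
    c = w ^ u * suc k
    k′ = pred c
    suc-k≤c : suc k ≤ c
    suc-k≤c = m≤n*m (suc k) (w ^ u) {{m^n≢0 w u}}
    suc-k′ : suc k′ ≡ c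
    suc-k′ = suc-pred c {{>-nonZero (≤-trans z<s suc-k≤c)}}
    k≤k′ : k ≤ k′
    k≤k′ = ≤-pred (subst (suc k ≤_) (sym suc-k′) suc-k≤c)
    mc≤ : suc m * c ≤ q ^ u * suc k
    mc≤ = subst (_≤ q ^ u * suc k) (*-assoc (suc m) (w ^ u) (suc k)) (*-monoˡ-≤ (suc k) le)
    cancel : ∀ a b → (a ℚ.+ b) ℚ.- a ≡ b
    cancel = +-*-Solver.solve 2 (λ a b → (a :+ b) :- a := b) refl
      where open +-*-Solver

fraction-* : ∀ i j c d → pos i / suc c ℚ.* (pos j / suc d) ≡ pos (i * j) / (suc c * suc d)
fraction-* i j c d = ℚ.toℚᵘ-injective (begin-equality
  ℚ.toℚᵘ (pos i / suc c ℚ.* (pos j / suc d))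
    ≃⟨ ℚ.toℚᵘ-homo-* (pos i / suc c) (pos j / suc d) ⟩
  ℚ.toℚᵘ (pos i / suc c) ℚᵘ.* ℚ.toℚᵘ (pos j / suc d)
    ≃⟨ ℚᵘ.*-cong (ℚ.toℚᵘ-fromℚᵘ (ℚᵘ.mkℚᵘ (pos i) c)) (ℚ.toℚᵘ-fromℚᵘ (ℚᵘ.mkℚᵘ (pos j) d)) ⟩
  ℚᵘ.mkℚᵘ (pos i) c ℚᵘ.* ℚᵘ.mkℚᵘ (pos j) d
    ≡⟨ cong (λ x → ℚᵘ.mkℚᵘ x (d + c * suc d)) (ℤ.pos-* i j) ⟨
  ℚᵘ.mkℚᵘ (pos (i * j)) (d + c * suc d)
    ≃⟨ ℚ.toℚᵘ-fromℚᵘ (ℚᵘ.mkℚᵘ (pos (i * j)) (d + c * suc d)) ⟨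
  ℚ.toℚᵘ (pos (i * j) / (suc c * suc d)) ∎)
  where
  open ℚᵘ.≤-Reasoning

fraction-≡ : ∀ i j a b → i * suc b ≡ j * suc a → pos i / suc a ≡ pos j / suc b
fraction-≡ i j a b eq = ℚ.≤-antisym (fraction-≤ i j a b (≤-reflexive eq))
                                  (fraction-≤ j i b a (≤-reflexive (sym eq)))

fraction-self : ∀ k → pos (suc k) / suc k ≡ 1ℚ
fraction-self k = fraction-≡ (suc k) 1 k 0 (*-comm (suc k) 1)

fraction-+ : ∀ i j c → pos (i + j) / suc c ≡ pos i / suc c ℚ.+ pos j / suc c
fraction-+ zero    j c = begin
  pos j / suc c                    ≡⟨ ℚ.+-identityˡ (pos j / suc c) ⟨
  0ℚ ℚ.+ pos j / suc c             ≡⟨ cong (ℚ._+ pos j / suc c) (fraction-≡ 0 0 c 0 refl) ⟨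
  pos 0 / suc c ℚ.+ pos j / suc c  ∎
  where open ≡-Reasoning
fraction-+ (suc i) j c = begin
  pos (suc (i + j)) / suc c                          ≡⟨ fraction-suc (i + j) c ⟩
  pos (i + j) / suc c ℚ.+ pos 1 / suc c              ≡⟨ cong (ℚ._+ pos 1 / suc c) (fraction-+ i j c) ⟩
  pos i / suc c ℚ.+ pos j / suc c ℚ.+ pos 1 / suc c  ≡⟨ swap (pos i / suc c) (pos j / suc c) (pos 1 / suc c) ⟩
  pos i / suc c ℚ.+ pos 1 / suc c ℚ.+ pos j / suc c  ≡⟨ cong (ℚ._+ pos j / suc c) (fraction-suc i c) ⟨
  pos (suc i) / suc c ℚ.+ pos j / suc c              ∎
  where
  open ≡-Reasoning
  swap : ∀ a b c → a ℚ.+ b ℚ.+ c ≡ a ℚ.+ c ℚ.+ b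
  swap = +-*-Solver.solve 3 (λ a b c → a :+ b :+ c := a :+ c :+ b) refl
    where open +-*-Solver

1-1/[1+k] : ∀ k → pos 1 / 1 ℚ.+ ℚ.- (pos 1 / suc k) ≡ pos k / suc k
1-1/[1+k] k = begin
  1ℚ ℚ.+ ℚ.- x                   ≡⟨ cong (ℚ._+ ℚ.- x) (fraction-self k) ⟨
  pos (suc k) / suc k ℚ.+ ℚ.- x  ≡⟨ cong (ℚ._+ ℚ.- x) (fraction-suc k k) ⟩
  pos k / suc k ℚ.+ x ℚ.+ ℚ.- x  ≡⟨ cancel (pos k / suc k) x ⟩
  pos k / suc k                  ∎
  where
  open ≡-Reasoning
  x : ℚ
  x = pos 1 / suc k
  cancel : ∀ a b → a ℚ.+ b ℚ.+ ℚ.- b ≡ a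
  cancel = +-*-Solver.solve 2 (λ a b → a :+ b :+ (:- b) := a) refl
    where open +-*-Solver

-- Uses ln (1 + D) ≤ u / w and ln 2 ≤ 1, at each index of the Cauchy sequences.
termBound : ∀ v u D n k t → suc D * suc v ^ u ≤ suc (suc v) ^ u →
  (u + 2 * suc v) * n * k ≤ t * (suc v * suc D * suc k) → ∀ i →
  (seq (ln (suc D)) i ℚ.+ seq (ln 2) i ℚ.+ pos 1 / 1) ℚ.* (pos 1 / suc D) ℚ.* (pos n / 1) ℚ.* (pos 1 / 1 ℚ.+ ℚ.- (pos 1 / suc k))
    ℚ.≤ pos t / 1
termBound v u D n k t ln≤ nat i = begin
  (seq (ln (suc D)) i ℚ.+ seq (ln 2) i ℚ.+ pos 1 / 1) ℚ.* (pos 1 / suc D) ℚ.* (pos n / 1) ℚ.* (pos 1 / 1 ℚ.+ ℚ.- (pos 1 / suc k))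
    ≡⟨ cong (λ x → (seq (ln (suc D)) i ℚ.+ seq (ln 2) i ℚ.+ pos 1 / 1) ℚ.* (pos 1 / suc D) ℚ.* (pos n / 1) ℚ.* x) (1-1/[1+k] k) ⟩
  (seq (ln (suc D)) i ℚ.+ seq (ln 2) i ℚ.+ pos 1 / 1) ℚ.* (pos 1 / suc D) ℚ.* (pos n / 1) ℚ.* (pos k / suc k)
    ≤⟨ mono k k (mono n 0 (mono 1 D lns)) ⟩
  (pos (u + 2 * w) / w) ℚ.* (pos 1 / suc D) ℚ.* (pos n / 1) ℚ.* (pos k / suc k)
    ≡⟨ cong (λ x → x ℚ.* (pos n / 1) ℚ.* (pos k / suc k)) (fraction-* (u + 2 * w) 1 v D) ⟩
  (pos ((u + 2 * w) * 1) / (w * suc D)) ℚ.* (pos n / 1) ℚ.* (pos k / suc k)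
    ≡⟨ cong (λ x → x ℚ.* (pos k / suc k)) (fraction-* ((u + 2 * w) * 1) n (D + v * suc D) 0) ⟩
  (pos ((u + 2 * w) * 1 * n) / (w * suc D * 1)) ℚ.* (pos k / suc k)
    ≡⟨ fraction-* ((u + 2 * w) * 1 * n) k ((D + v * suc D) * 1) k ⟩
  pos ((u + 2 * w) * 1 * n * k) / (w * suc D * 1 * suc k)
    ≤⟨ fraction-≤ ((u + 2 * w) * 1 * n * k) t (k + (D + v * suc D) * 1 * suc k) 0
         (≤-trans (≤-reflexive (lem₁ (u + 2 * w) n k))
           (≤-trans nat (≤-reflexive (cong (λ x → t * (x * suc k)) (sym (*-identityʳ (w * suc D))))))) ⟩
  pos t / 1 ∎
  where
  open ℚ.≤-Reasoning
  w : ℕ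
  w = suc v
  lem₁ : ∀ x n k → x * 1 * n * k * 1 ≡ x * n * k
  lem₁ = solve-∀
  mono : ∀ j d {p q} → p ℚ.≤ q → p ℚ.* (pos j / suc d) ℚ.≤ q ℚ.* (pos j / suc d)
  mono j d = ℚ.*-monoʳ-≤-nonNeg (pos j / suc d) {{ℚ.nonNegative (0≤fraction j d)}}
  two : pos (u + 2 * w) / w ≡ pos u / w ℚ.+ 1ℚ ℚ.+ 1ℚ
  two = trans (cong (λ x → pos x / w) (lem₂ u w)) (trans (fraction-+ (u + w) w v)
    (cong₂ ℚ._+_ (trans (fraction-+ u w v) (cong (λ x → pos u / w ℚ.+ x) (fraction-self v))) (fraction-self v)))
    where
    lem₂ : ∀ u w → u + 2 * w ≡ u + w + w
    lem₂ = solve-∀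
  lns : seq (ln (suc D)) i ℚ.+ seq (ln 2) i ℚ.+ pos 1 / 1 ℚ.≤ pos (u + 2 * w) / w
  -- For ln 2 the ratio `q / w` is 2/1, with a single piece.
  lns = ℚ.≤-trans (ℚ.+-monoˡ-≤ (pos 1 / 1) (ℚ.+-mono-≤ (ln-upper v D u ln≤ i) (ln-upper 0 1 1 ≤-refl i)))
    (ℚ.≤-reflexive (sym two))

-- Choice of the parameters

lastBefore : ∀ {P : ℕ → Set} → Decidable P → ∀ m z → P z → ¬ P (m + z) →
             ∃[ y ] z ≤ y × P y × ¬ P (suc y)
lastBefore P? zero    z Pz ¬P = ⊥-elim (¬P Pz)
lastBefore {P} P? (suc m) z Pz ¬P with P? (suc z)
... | no ¬Psz = z , ≤-refl , Pz , ¬Psz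
... | yes Psz with lastBefore P? m (suc z) Psz (subst (λ i → ¬ P i) (sym (+-suc m z)) ¬P)
...   | y , z<y , Py , ¬Psy = y , <⇒≤ z<y , Py , ¬Psy

n<[m/n+1]*n : ∀ m n .{{_ : NonZero n}} → m < suc (m ℕ./ n) * n
n<[m/n+1]*n m n = begin-strict
  m                  ≡⟨ m≡m%n+[m/n]*n m n ⟩
  m ℕ.% n + m ℕ./ n * n  <⟨ +-monoˡ-< (m ℕ./ n * n) (m%n<n m n) ⟩
  suc (m ℕ./ n) * n    ∎
  where open ≤-Reasoning

m*b≤1+n⇒b+b≤n : ∀ b n M → 1 ≤ b → 4 ≤ M → M * b ≤ suc n → b + b ≤ n
m*b≤1+n⇒b+b≤n b n M 1≤b 4≤M h = s≤s⁻¹ (begin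
  suc (b + b)        ≤⟨ +-monoˡ-≤ (b + b) 1≤b ⟩
  b + (b + b)        ≤⟨ +-monoʳ-≤ b (+-monoʳ-≤ b (m≤m+n b (b + 0))) ⟩
  4 * b              ≤⟨ *-monoˡ-≤ b 4≤M ⟩
  M * b              ≤⟨ h ⟩
  suc n              ∎)
  where open ≤-Reasoning

sparseGraph : ∀ w t d u h {a n} → .{{NonZero w}} → .{{NonZero t}} → suc w * d + t ≤ a → suc a < 2 ^ u →
  suc w ^ t ≤ suc h * w ^ t → suc d + suc d ≤ a → t < a → a + suc h * (u * t) * suc t ≡ n →
  Σ[ G ∈ Graph n ] t < γg G × d ≤ δ′ G
sparseGraph w t d u h fit a<2^u ratio 2d+2≤a t<a refl
  with missingFamily w t d u h fit a<2^u ratio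
... | S , S-size , dodge = extremalGraph S S-size dodge 2d+2≤a t<a

-- `M` is such that at most (n+1)/M vertices lie outside `Fin a`. `y` = 4q makes y*z = t + 4*z for t
-- = 4*w*z: the power t of `q / w` goes into the number of sets, and the power 4*z outweighs
-- constants and polylogarithmic factors once z ≥ `Z`. The summand 2*w of `Z` pays for rounding the
-- logarithm and for ln 2 + 1.
module Parameters (v : ℕ) where

  w q M y Z : ℕ
  w = suc v
  q = suc w
  M = 2 * q
  y = 4 * q
  Z = 4 * M * w ^ 4 * y ^ 3 + 2 * w

  -- Bernoulli again; it guarantees that the search for the exponent stops.
  exponential>linear : ∀ n m → n * w ≤ m → n * w ^ suc m < q ^ suc m
  exponential>linear n m h = begin-strict
    n * w ^ suc m              ≡⟨ lem n w (w ^ m) ⟩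
    w ^ m * (n * w)            <⟨ *-monoʳ-< (w ^ m) {{m^n≢0 w m}} (≤-<-trans h (m<n+m m z<s)) ⟩
    w ^ m * (w + m)            ≤⟨ *-monoʳ-≤ (w ^ m) (+-monoʳ-≤ w (≤-trans (n≤1+n m) (≤-reflexive (sym (*-identityʳ (suc m)))))) ⟩
    w ^ m * (w + suc m * 1)    ≤⟨ bernoulli w 1 m ⟩
    (w + 1) ^ suc m            ≡⟨ cong (_^ suc m) (+-comm w 1) ⟩
    q ^ suc m                  ∎
    where
    open ≤-Reasoning
    lem : ∀ a b c → a * (b * c) ≡ c * (a * b)
    lem = solve-∀

  -- The fourth power of Bernoulli's (q / w) ^ z ≥ z / w: the growth is faster than cubic.
  exponential≥quartic : ∀ z .{{_ : NonZero z}} → w ^ (4 * z) * z ^ 4 ≤ q ^ (4 * z) * w ^ 4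
  exponential≥quartic z@(suc z-1) = begin
    w ^ (4 * z) * z ^ 4    ≡⟨ fourth w z ⟩
    (w ^ z * z) ^ 4        ≤⟨ ^-monoˡ-≤ 4 first ⟩
    (q ^ z * w) ^ 4        ≡⟨ fourth q w ⟨
    q ^ (4 * z) * w ^ 4    ∎
    where
    open ≤-Reasoning
    fourth : ∀ a b → a ^ (4 * z) * b ^ 4 ≡ (a ^ z * b) ^ 4
    fourth a b = trans (cong (_* b ^ 4) (trans (cong (a ^_) (*-comm 4 z)) (sym (^-*-assoc a z 4))))
      (sym (^-distribʳ-* (a ^ z) b 4))
    lem : ∀ a b c → a * b * c ≡ b * c * a
    lem = solve-∀
    first : w ^ z * z ≤ q ^ z * w
    first = begin
      w * w ^ z-1 * z              ≡⟨ lem w (w ^ z-1) z ⟩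
      w ^ z-1 * z * w              ≤⟨ *-monoˡ-≤ w (*-monoʳ-≤ (w ^ z-1)
                                        (≤-trans (≤-reflexive (sym (*-identityʳ z))) (m≤n+m (z * 1) w))) ⟩
      w ^ z-1 * (w + z * 1) * w    ≤⟨ *-monoˡ-≤ w (bernoulli w 1 z-1) ⟩
      (w + 1) ^ z * w              ≡⟨ cong (λ i → i ^ z * w) (+-comm w 1) ⟩
      q ^ z * w                    ∎

  threshold : ℕ
  threshold = q ^ (y * Z)

  Below : ℕ → ℕ → Set
  Below n z = q ^ (y * z) ≤ suc n * w ^ (y * z)

  -- z is, up to the factor y and rounding, the logarithm of n + 1 to the base q / w.
  exponent : ∀ n → threshold ≤ n → ∃[ z ] Z ≤ z × Below n z × ¬ Below n (suc z)
  exponent n large = lastBefore (λ z → q ^ (y * z) ≤? suc n * w ^ (y * z)) (suc (suc n * w)) Z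
    (≤-trans large (≤-trans (n≤1+n n) (m≤m*n (suc n) (w ^ (y * Z)) {{m^n≢0 w (y * Z)}})))
    (<⇒≱ (exponential>linear (suc n) _ (≤-trans (m≤m+n (suc n * w) Z)
      (m≤m+n (suc n * w + Z) (pred y * suc (suc n * w + Z))))))

  -- `t` is the fraction w/q = 1 - 1/q of y*z, hence of the logarithm of n + 1 to the base `q / w`
  -- up to rounding. `suc h` is the least integer above (q/w)ᵗ, the reciprocal of the missing
  -- probability. `d` is the largest size with q*d + t ≤ |A|, as `miss-fraction` demands.
  module AtOrder (n z : ℕ) (Z≤z : Z ≤ z) (below : Below n z) (¬below : ¬ Below n (suc z)) where

    t u Q P h r |B| |A| d : ℕ
    t = 4 * w * z
    u = y * suc z
    Q = q ^ t
    P = w ^ t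
    h = ℕ._/_ Q P {{m^n≢0 w t}}
    r = suc h * (u * t)
    |B| = r * suc t
    |A| = n ∸ |B|
    d = (|A| ∸ t) ℕ./ q

    open ≤-Reasoning

    2w≤z : 2 * w ≤ z
    2w≤z = ≤-trans (m≤n+m (2 * w) (4 * M * w ^ 4 * y ^ 3)) Z≤z

    1≤z : 1 ≤ z
    1≤z = ≤-trans (s≤s z≤n) 2w≤z

    instance
      z≢0 : NonZero z
      z≢0 = >-nonZero 1≤z
      P≢0 : NonZero P
      P≢0 = m^n≢0 w t
      w^≢0 : NonZero (w ^ (4 * z))
      w^≢0 = m^n≢0 w (4 * z)

    4≤t : 4 ≤ t
    4≤t = begin
      4            ≤⟨ m≤m*n 4 (w * z) {{m*n≢0 w z}} ⟩
      4 * (w * z)  ≡⟨ *-assoc 4 w z ⟨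
      t            ∎

    n+1<[q/w]^u : suc n * w ^ u < q ^ u
    n+1<[q/w]^u = ≰⇒> ¬below

    -- Replacing the base `q / w` by 2 is wasteful, but here `u` only contributes a logarithmic
    -- factor to |B|.
    n+1<2^u : suc n < 2 ^ u
    n+1<2^u = *-cancelʳ-< (w ^ u) (suc n) (2 ^ u) (begin-strict
      suc n * w ^ u  <⟨ n+1<[q/w]^u ⟩
      q ^ u          ≤⟨ ^-monoˡ-≤ u (≤-trans (+-monoˡ-≤ w (s≤s (z≤n {v}))) (≤-reflexive (cong (w +_) (sym (+-identityʳ w))))) ⟩
      (2 * w) ^ u    ≡⟨ ^-distribʳ-* 2 w u ⟩
      2 ^ u * w ^ u  ∎)

    -- K is at most a constant times z ^ 3, which is why the fourth power suffices.
    K : ℕ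
    K = 2 * M * (u * t * suc t)

    K≤ : K ≤ 4 * M * y ^ 3 * z ^ 3
    K≤ = begin
      2 * M * (u * t * suc t)
        ≤⟨ *-monoʳ-≤ (2 * M) (*-mono-≤ (*-mono-≤ u≤ (≤-trans (n≤1+n t) t<)) t<) ⟩
      2 * M * (2 * (y * z) * (y * z) * (y * z))
        ≡⟨ lem M y z ⟩
      4 * M * y ^ 3 * z ^ 3 ∎
      where
      u≤ : u ≤ 2 * (y * z)
      u≤ = begin
        y * suc z    ≤⟨ *-monoʳ-≤ y (+-monoˡ-≤ z 1≤z) ⟩
        y * (z + z)  ≡⟨ lem′ y z ⟩
        2 * (y * z)  ∎
        where
        lem′ : ∀ y z → y * (z + z) ≡ 2 * (y * z)
        lem′ = solve-∀
      t< : t < y * z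
      t< = *-monoˡ-< z (*-monoʳ-< 4 (n<1+n w))
      lem : ∀ M y z → 2 * M * (2 * (y * z) * (y * z) * (y * z)) ≡ 4 * M * (y * (y * (y * 1))) * (z * (z * (z * 1)))
      lem = solve-∀

    growth : K * w ^ (4 * z) ≤ q ^ (4 * z)
    growth = *-cancelʳ-≤ _ _ (w ^ 4) (begin
      K * w ^ (4 * z) * w ^ 4
        ≤⟨ *-monoˡ-≤ (w ^ 4) (*-monoˡ-≤ (w ^ (4 * z)) K≤) ⟩
      4 * M * y ^ 3 * z ^ 3 * w ^ (4 * z) * w ^ 4
        ≡⟨ lem M (y ^ 3) (z ^ 3) (w ^ (4 * z)) (w ^ 4) ⟩
      w ^ (4 * z) * (4 * M * w ^ 4 * y ^ 3 * z ^ 3)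
        ≤⟨ *-monoʳ-≤ (w ^ (4 * z)) (*-monoˡ-≤ (z ^ 3) (≤-trans (m≤m+n _ (2 * w)) Z≤z)) ⟩
      w ^ (4 * z) * z ^ 4
        ≤⟨ exponential≥quartic z ⟩
      q ^ (4 * z) * w ^ 4 ∎)
      where
      lem : ∀ M Y Z E W → 4 * M * Y * Z * E * W ≡ E * (4 * M * W * Y * Z)
      lem = solve-∀

    yz≡ : y * z ≡ t + 4 * z
    yz≡ = lem w z
      where
      lem : ∀ w z → 4 * suc w * z ≡ 4 * w * z + 4 * z
      lem = solve-∀

    KQ≤ : K * Q ≤ suc n * P
    KQ≤ = *-cancelʳ-≤ _ _ (w ^ (4 * z)) (begin
      K * Q * w ^ (4 * z)        ≡⟨ lem K Q (w ^ (4 * z)) ⟩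
      Q * (K * w ^ (4 * z))      ≤⟨ *-monoʳ-≤ Q growth ⟩
      Q * q ^ (4 * z)            ≡⟨ ^-distribˡ-+-* q t (4 * z) ⟨
      q ^ (t + 4 * z)            ≡⟨ cong (q ^_) yz≡ ⟨
      q ^ (y * z)                ≤⟨ below ⟩
      suc n * w ^ (y * z)        ≡⟨ cong (λ i → suc n * w ^ i) yz≡ ⟩
      suc n * w ^ (t + 4 * z)    ≡⟨ cong (suc n *_) (^-distribˡ-+-* w t (4 * z)) ⟩
      suc n * (P * w ^ (4 * z))  ≡⟨ *-assoc (suc n) P (w ^ (4 * z)) ⟨
      suc n * P * w ^ (4 * z)    ∎)
      where
      lem : ∀ a b c → a * b * c ≡ b * (a * c)
      lem = solve-∀

    [h+1]P≤2Q : suc h * P ≤ 2 * Q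
    [h+1]P≤2Q = begin
      P + h * P  ≤⟨ +-mono-≤ (^-monoˡ-≤ t (n≤1+n w)) (m/n*n≤m Q P) ⟩
      Q + Q      ≡⟨ cong (Q +_) (+-identityʳ Q) ⟨
      2 * Q      ∎

    Mb≤n+1 : M * |B| ≤ suc n
    Mb≤n+1 = *-cancelʳ-≤ _ _ P (begin
      M * (suc h * (u * t) * suc t) * P  ≡⟨ lem₁ M (suc h) (u * t) (suc t) P ⟩
      M * (u * t * suc t) * (suc h * P)  ≤⟨ *-monoʳ-≤ (M * (u * t * suc t)) [h+1]P≤2Q ⟩
      M * (u * t * suc t) * (2 * Q)      ≡⟨ lem₂ M (u * t * suc t) Q ⟩
      K * Q                              ≤⟨ KQ≤ ⟩
      suc n * P                          ∎)
      where
      lem₁ : ∀ M h x s P → M * (h * x * s) * P ≡ M * (x * s) * (h * P)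
      lem₁ = solve-∀
      lem₂ : ∀ M x Q → M * x * (2 * Q) ≡ 2 * M * x * Q
      lem₂ = solve-∀

    t<|B| : t < |B|
    t<|B| = m≤n*m (suc t) r {{m*n≢0 (suc h) (u * t) {{_}} {{m*n≢0 u t {{m*n≢0 y (suc z)}} {{>-nonZero (≤-trans (s≤s z≤n) 4≤t)}}}}}}

    2b≤n : |B| + |B| ≤ n
    2b≤n = m*b≤1+n⇒b+b≤n |B| n M (≤-trans (s≤s z≤n) t<|B|) (*-monoʳ-≤ 2 (s≤s (s≤s (z≤n {v})))) Mb≤n+1

    |B|≤n : |B| ≤ n
    |B|≤n = ≤-trans (m≤m+n |B| |B|) 2b≤n

    |A|+|B|≡n : |A| + |B| ≡ n
    |A|+|B|≡n = m∸n+n≡m |B|≤n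

    t<|A| : t < |A|
    t<|A| = ≤-trans t<|B| (m+n≤o⇒m≤o∸n |B| 2b≤n)

    qd+t≤|A| : q * d + t ≤ |A|
    qd+t≤|A| = begin
      q * d + t    ≡⟨ cong (_+ t) (*-comm q d) ⟩
      d * q + t    ≤⟨ +-monoˡ-≤ t (m/n*n≤m (|A| ∸ t) q) ⟩
      |A| ∸ t + t  ≡⟨ m∸n+n≡m (<⇒≤ t<|A|) ⟩
      |A|          ∎

    2d+2≤|A| : suc d + suc d ≤ |A|
    2d+2≤|A| = begin
      suc d + suc d  ≡⟨ lem d ⟩
      2 * d + 2      ≤⟨ +-mono-≤ (*-monoˡ-≤ d (s≤s (s≤s (z≤n {v})))) (≤-trans (s≤s (s≤s z≤n)) 4≤t) ⟩
      q * d + t      ≤⟨ qd+t≤|A| ⟩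
      |A|            ∎
      where
      lem : ∀ d → suc d + suc d ≡ 2 * d + 2
      lem = solve-∀

    -- Two losses occur besides rounding: the |B| vertices outside `Fin a`, and the `t` vertices set
    -- aside in the definition of `d`, fewer than |B|.
    n<q[d+1]+2b : suc n ≤ suc d * q + 2 * |B|
    n<q[d+1]+2b = begin
      suc n                    ≡⟨ cong suc |A|+|B|≡n ⟨
      suc (|A| + |B|)          ≡⟨ cong (λ i → suc (i + |B|)) (m∸n+n≡m (<⇒≤ t<|A|)) ⟨
      suc (|A| ∸ t + t + |B|)  ≤⟨ +-monoˡ-≤ |B| (+-mono-≤ (n<[m/n+1]*n (|A| ∸ t) q) (<⇒≤ t<|B|)) ⟩
      suc d * q + |B| + |B|    ≡⟨ lem (suc d * q) |B| ⟩
      suc d * q + 2 * |B|      ∎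
      where
      lem : ∀ x b → x + b + b ≡ x + 2 * b
      lem = solve-∀

    -- This is d + 1 ≥ (1 - 1/q) n/q. After multiplication by `q` the loss 2*q*|B| is M*|B|, at most
    -- one of the `q` copies of n + 1.
    wn≤ : w * n ≤ q * q * suc d
    wn≤ = ≤-trans (*-monoʳ-≤ w (n≤1+n n)) (+-cancelʳ-≤ (suc n) _ _ (begin
      w * suc n + suc n          ≡⟨ +-comm (w * suc n) (suc n) ⟩
      q * suc n                  ≤⟨ *-monoʳ-≤ q n<q[d+1]+2b ⟩
      q * (suc d * q + 2 * |B|)  ≡⟨ lem q (suc d) |B| ⟩
      q * q * suc d + M * |B|    ≤⟨ +-monoʳ-≤ (q * q * suc d) Mb≤n+1 ⟩
      q * q * suc d + suc n      ∎))
      where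
      lem : ∀ q d b → q * (d * q + 2 * b) ≡ q * q * d + 2 * q * b
      lem = solve-∀

    graph : Σ[ G ∈ Graph n ] t < γg G × d ≤ δ′ G
    graph = sparseGraph w t d u h {|A|} {{_}} {{>-nonZero (≤-trans (s≤s z≤n) 4≤t)}} qd+t≤|A|
      (≤-<-trans (s≤s (m∸n≤m n |B|)) n+1<2^u) (<⇒≤ (n<[m/n+1]*n Q P)) 2d+2≤|A| t<|A| |A|+|B|≡n

  -- Relative to t = 4*w*z, the factor y*(z+1) + 2*w loses at most (q/w)²; relative to w*D, the
  -- factor n loses another (q/w)². The hypothesis on `k` absorbs the fourth power.
  numerical : ∀ z n D k → 2 * w ≤ z → w * n ≤ q * q * D → q ^ 4 * k ≤ w ^ 4 * suc k →
              (y * suc z + 2 * w) * n * k ≤ 4 * w * z * (w * D * suc k)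
  numerical z n D k 2w≤z wn≤ ratio = *-cancelʳ-≤ _ _ (w * w) (begin
    (y * suc z + 2 * w) * n * k * (w * w)
      ≡⟨ lem₁ (y * suc z + 2 * w) n k w ⟩
    (y * suc z + 2 * w) * w * (w * n) * k
      ≤⟨ *-monoˡ-≤ k (*-mono-≤ first wn≤) ⟩
    4 * (q * q) * z * (q * q * D) * k
      ≡⟨ lem₂ q z D k ⟩
    4 * z * D * (q ^ 4 * k)
      ≤⟨ *-monoʳ-≤ (4 * z * D) ratio ⟩
    4 * z * D * (w ^ 4 * suc k)
      ≡⟨ lem₃ w z D (suc k) ⟩
    4 * w * z * (w * D * suc k) * (w * w) ∎)
    where
    open ≤-Reasoning
    lem₁ : ∀ x n k w → x * n * k * (w * w) ≡ x * w * (w * n) * k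
    lem₁ = solve-∀
    lem₂ : ∀ q z D k → 4 * (q * q) * z * (q * q * D) * k ≡ 4 * z * D * (q * (q * (q * (q * 1))) * k)
    lem₂ = solve-∀
    lem₃ : ∀ w z D k → 4 * z * D * (w * (w * (w * (w * 1))) * k) ≡ 4 * w * z * (w * D * k) * (w * w)
    lem₃ = solve-∀
    first : (y * suc z + 2 * w) * w ≤ 4 * (q * q) * z
    first = begin
      (4 * q * suc z + 2 * w) * w                    ≤⟨ m≤m+n _ (2 * w * w + 4 * w) ⟩
      (4 * q * suc z + 2 * w) * w + (2 * w * w + 4 * w) ≡⟨ lem w z ⟩
      4 * q * (w * z + 2 * w)                        ≤⟨ *-monoʳ-≤ (4 * q) (+-monoʳ-≤ (w * z) 2w≤z) ⟩
      4 * q * (w * z + z)                            ≡⟨ lem′ w z ⟩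
      4 * (q * q) * z                                ∎
      where
      lem : ∀ w z → (4 * suc w * suc z + 2 * w) * w + (2 * w * w + 4 * w)
          ≡ 4 * suc w * (w * z + 2 * w)
      lem = solve-∀
      lem′ : ∀ w z → 4 * suc w * (w * z + z) ≡ 4 * (suc w * suc w) * z
      lem′ = solve-∀

-- From a fixed relative loss to o(1).

δ′≤n : ∀ {n} (G : Graph n) → δ′ G ≤ n
δ′≤n {n} G = ≤-trans (m⊓n≤m (δ G) (δ (complement G))) (min≤⊤ n (map (degree G) (allFin n)))

-- Bernoulli: (1 - 1/(4k+4))⁴ ≥ 1 - 4/(4k+4) = k/(k+1).
fourthPower-ratio : ∀ k → suc (suc (2 + 4 * k)) ^ 4 * k ≤ suc (2 + 4 * k) ^ 4 * suc k
fourthPower-ratio k = ≤-trans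
  (m≤m+n _ ((96 * k * k + 176 * k + 81) * suc k)) (≤-reflexive (lem k))
  where
  lem : ∀ k → let q = suc (suc (2 + 4 * k)) ; w = suc (2 + 4 * k) in
    q * (q * (q * (q * 1))) * k + (96 * k * k + 176 * k + 81) * suc k ≡ w * (w * (w * (w * 1))) * suc k
  lem = solve-∀

bound : ∀ {n} → Graph n → ℝ → ℝ
bound {n} G ε = (ln (suc (δ′ G)) +ᴿ ln 2 +ᴿ fromℕ 1) ÷ᴿ suc (δ′ G) *ᴿ fromℕ n *ᴿ (fromℕ 1 +ᴿ ε)

-1/[1+_] : ℕ → ℚ
-1/[1+ k ] = ℚ.- (pos 1 / suc k)

-- The value of δ′ stays unknown: δ′ ≤ n is inserted in the logarithm and δ′ ≥ d in the denominator.
-- Since d is about n/q, the logarithm grows only by about ln q. The estimate holds at every index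
-- of the Cauchy sequences, hence the witness 0.
bound≤γg : ∀ v z d n k (G : Graph n) → let open Parameters v in
  2 * w ≤ z → suc n * w ^ (y * suc z) ≤ q ^ (y * suc z) → w * n ≤ q * q * suc d →
  q ^ 4 * k ≤ w ^ 4 * suc k → 4 * w * z < γg G → d ≤ δ′ G →
  fromℕ (γg G) ≥ᴿ bound G (fromℚ -1/[1+ k ])
bound≤γg v z d n k G 2w≤z n+1≤ wn≤ ratio t<γ d≤δ′ ε 0<ε = 0 , λ i _ → begin
  seq (bound G (fromℚ -1/[1+ k ])) i
    ≤⟨ termBound v (y * suc z) (δ′ G) n k (4 * w * z)
         (≤-trans (*-monoˡ-≤ (w ^ (y * suc z)) (s≤s (δ′≤n G))) n+1≤)
         (numerical z n (suc (δ′ G)) k 2w≤z (≤-trans wn≤ (*-monoʳ-≤ (q * q) (s≤s d≤δ′))) ratio)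
         i ⟩
  pos (4 * w * z) / 1
    ≤⟨ fraction-≤ (4 * w * z) (γg G) 0 0 (*-monoˡ-≤ 1 (<⇒≤ t<γ)) ⟩
  pos (γg G) / 1
    ≡⟨ ℚ.+-identityʳ (pos (γg G) / 1) ⟨
  pos (γg G) / 1 ℚ.+ 0ℚ
    ≤⟨ ℚ.+-monoʳ-≤ (pos (γg G) / 1) (ℚ.<⇒≤ 0<ε) ⟩
  pos (γg G) / 1 ℚ.+ ε ∎
  where
  open Parameters v
  open ℚ.≤-Reasoning

threshold : ℕ → ℕ
threshold k = Parameters.threshold (2 + 4 * k)

extremal : ∀ k n → threshold k ≤ n →
           Σ[ G ∈ Graph n ] fromℕ (γg G) ≥ᴿ bound G (fromℚ -1/[1+ k ])
extremal k n large = go (exponent n large)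
  where
  open Parameters (2 + 4 * k) hiding (threshold)
  go : ∃[ z ] Z ≤ z × Below n z × ¬ Below n (suc z) →
       Σ[ G ∈ Graph n ] fromℕ (γg G) ≥ᴿ bound G (fromℚ -1/[1+ k ])
  go (z , Z≤z , below , ¬below) = proj₁ graph ,
    bound≤γg (2 + 4 * k) z d n k (proj₁ graph) 2w≤z (<⇒≤ n+1<[q/w]^u) wn≤ (fourthPower-ratio k)
      (proj₁ (proj₂ graph)) (proj₂ (proj₂ graph))
    where open AtOrder n z Z≤z below ¬below

-- The junk value is 0, when there is no j ≤ k with f j ≤ n.
largestBelow : (ℕ → ℕ) → ℕ → ℕ → ℕ
largestBelow f n zero    = 0
largestBelow f n (suc k) with f (suc k) ≤? n
... | yes _ = suc k
... | no  _ = largestBelow f n k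

largestBelow-sound : ∀ (f : ℕ → ℕ) n k → f 0 ≤ n → f (largestBelow f n k) ≤ n
largestBelow-sound f n zero    h = h
largestBelow-sound f n (suc k) h with f (suc k) ≤? n
... | yes le = le
... | no  _  = largestBelow-sound f n k h

largestBelow-max : ∀ (f : ℕ → ℕ) n k {j} → j ≤ k → f j ≤ n → j ≤ largestBelow f n k
largestBelow-max f n zero    j≤k h = j≤k
largestBelow-max f n (suc k) j≤k h with f (suc k) ≤? n
... | yes _ = j≤k
... | no ≰n = largestBelow-max f n k (m<1+n⇒m≤n (≤∧≢⇒< j≤k λ { refl → ≰n h })) h

fromℚ-mono : ∀ {p r} → p ℚ.≤ r → fromℚ p ≤ᴿ fromℚ r
fromℚ-mono {p} {r} p≤r ε 0<ε = 0 , λ _ _ → ℚ.≤-trans p≤r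
  (ℚ.≤-trans (ℚ.≤-reflexive (sym (ℚ.+-identityʳ r))) (ℚ.+-monoʳ-≤ r (ℚ.<⇒≤ 0<ε)))

-- For each `n`, take the largest `k` ≤ n with f k ≤ n: the cap makes the search finite, and from
-- max(j, f j) on this `k` is at least `j`, whether or not `f` is monotone. Starting at f 0 makes
-- the junk value 0 admissible.
diagonalise : (Q : ℕ → ℝ → Set₁) (f : ℕ → ℕ) → (∀ k n → f k ≤ n → Q n (fromℚ -1/[1+ k ])) →
              Σ[ o ∈ (ℕ → ℝ) ] TendsToZero o × (∃[ N ] ∀ n → N ≤ n → Q n (o n))
diagonalise Q f hyp = o , o→0 , f 0 , λ n f0≤n → hyp (k n) n (largestBelow-sound f n n f0≤n)
  where
  k : ℕ → ℕ
  k n = largestBelow f n n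
  o : ℕ → ℝ
  o n = fromℚ -1/[1+ k n ]
  o→0 : TendsToZero o
  o→0 ε 0<ε with archimedean ε 0<ε
  ... | j , 1/[1+j]≤ε = j ⊔ f j , λ n le →
    let j≤k = largestBelow-max f n n (m⊔n≤o⇒m≤o j (f j) le) (m⊔n≤o⇒n≤o j (f j) le)
        1/[1+k]≤ε = ℚ.≤-trans (fraction-≤ 1 1 (k n) j (*-monoʳ-≤ 1 (s≤s j≤k))) 1/[1+j]≤ε
    in fromℚ-mono (ℚ.neg-antimono-≤ 1/[1+k]≤ε) ,
       fromℚ-mono (ℚ.≤-trans (ℚ.neg-antimono-≤ (0≤fraction 1 (k n))) (ℚ.<⇒≤ 0<ε))

theorem11 : Σ[ o ∈ (ℕ → ℝ) ] TendsToZero o ×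
    (∃[ N ] ∀ n → N ≤ n → Σ[ G ∈ Graph n ]
    fromℕ (γg G) ≥ᴿ
    (ln (suc (δ′ G)) +ᴿ ln 2 +ᴿ fromℕ 1) ÷ᴿ suc (δ′ G) *ᴿ fromℕ n *ᴿ (fromℕ 1 +ᴿ o n))
theorem11 = diagonalise (λ n ε → Σ[ G ∈ Graph n ] fromℕ (γg G) ≥ᴿ bound G ε) threshold extremal
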